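{- Let $X$ be a finite set with similarity function $S$, suppose the target clustering $\mathcal{C}^{\ast}$ satisfies stability with respect to $S$, and suppose the initial clustering has correlation-clustering error $\delta_{cc}$. In the $\eta$-merge model, for any $\eta>2/3$, the interactive algorithm using the global split procedure and the correlation-clustering merge procedure (described below) requires at most $\delta_{cc}$ edit requests to find the target clustering.
   Context: For nonempty $A,A'\subseteq X$, $S(A,A')$ is the average of $S(x,y)$ over $x\in A,y\in A'$. $\mathcal{C}^{\ast}=\{C^{\ast}_1,\dots,C^{\ast}_k\}$ satisfies stability w.r.t. $S$ if for all $i\neq j$, every nonempty proper $A\subset C^{\ast}_i$ and nonempty $A'\subseteq C^{\ast}_j$: $S(A,C^{\ast}_i\setminus A)>S(A,A')$. For a clustering $\mathcal{C}$, $\delta_{cc}=|\{(u,v)\in X\times X: c(u,v)\neq c^{\ast}(u,v)\}|$, where $c(u,v)=1$ if $u,v$ lie in the same cluster of $\mathcal{C}$ and $0$ otherwise, and $c^{\ast}$ is defined likewise for $\mathcal{C}^{\ast}$. Average-linkage tree $T_{glob}$: leaves are singletons; repeatedly merge the two current nodes $N_1,N_2$ with largest $S(N_1,N_2)$ (ties arbitrary) into parent $N_1\cup N_2$ until the root $X$ remains. Process ($\eta$-merge model): starting from the initial clustering, an oracle repeatedly issues split$(C_i)$ (only if current cluster $C_i$ contains points from two or more target clusters) or merge$(C_i,C_j)$ for distinct current clusters (only if some target cluster $C^{\ast}_l$ has $|C_i\cap C^{\ast}_l|\ge\eta|C_i|$ and $|C_j\cap C^{\ast}_l|\ge\eta|C_j|$).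 Split procedure: let $N$ be the deepest node of $T_{glob}$ containing $C_i$, with children $N_1,N_2$; replace $C_i$ by $C_i\cap N_1$ and $C_i\cap N_2$. Correlation-clustering merge procedure: find a node $N$ of $T_{glob}$ of maximal depth with $|N\cap C_i|\ge\eta|C_i|$ and $|N\cap C_j|\ge\eta|C_j|$; if $|C_i|\ge|C_j|$, replace $C_i$ by $C_i\cup(N\cap C_j)$ and $C_j$ by $C_j\setminus N$; otherwise replace $C_i$ by $C_i\setminus N$ and $C_j$ by $C_j\cup(N\cap C_i)$ (empty clusters are discarded). The bound is on the number of requests before the current clustering equals $\mathcal{C}^{\ast}$, for any sequence of allowed requests. -}

module Defs where

open import Level using (Level; _⊔_; suc)
open import Algebra.Bundles using (CommutativeRing)
open import Data.Bool.Base using (Bool; if_then_else_)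
import Data.Bool.Properties as Bool
open import Data.Fin.Base using (Fin)
open import Data.Fin.Subset
  using (Subset; ⁅_⁆; _∈_; _⊆_; _⊂_; _∩_; _∪_; _─_; ∣_∣; Nonempty; Empty)
open import Data.Fin.Subset.Properties using (_∈?_; nonempty?)
open import Data.List.Base
  using (List; []; _∷_; _++_; allFin; cartesianProduct; filter; length; map)
import Data.List.Membership.Propositional as List
open import Data.List.Relation.Binary.Permutation.Propositional using (_↭_)
open import Data.List.Relation.Unary.All using (All)
open import Data.List.Relation.Unary.AllPairs using (AllPairs)
open import Data.List.Relation.Unary.Any using (Any; any?)
open import Data.Nat.Base as ℕ using (ℕ)
open import Data.Product.Base using (_×_; _,_; ∃; ∃₂)
open import Data.Vec.Base using (lookup)
open import Relation.Binary.Construct.Closure.ReflexiveTransitive using (Star)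
import Relation.Binary.Construct.StrictToNonStrict as StrictToNonStrict
open import Relation.Binary.Core using (Rel)
open import Relation.Binary.PropositionalEquality.Core using (_≢_)
open import Relation.Binary.Structures using (IsStrictTotalOrder)
open import Relation.Nullary.Decidable using (does; _×-dec_; ¬?)
import Algebra.Definitions.RawMonoid as RawMonoidDefinitions

private variable
  c ℓ₁ ℓ₂ : Level
  n : ℕ

-- Similarities and the parameter η are real numbers.  Only the linearly ordered
-- field structure of ℝ is used, so an arbitrary such field takes its place.
-- The inverse is total, with an unspecified value at 0#.
record OrderedField c ℓ₁ ℓ₂ : Set (suc (c ⊔ ℓ₁ ⊔ ℓ₂)) where
  infix  4 _<_ _≤_
  infix  8 _⁻¹
  field
    commutativeRing : CommutativeRing c ℓ₁
  open CommutativeRing commutativeRing public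
  field
    _<_                : Rel Carrier ℓ₂
    isStrictTotalOrder : IsStrictTotalOrder _≈_ _<_
    +-monoʳ-<          : ∀ x {y z} → y < z → x + y < x + z
    *-pos              : ∀ {x y} → 0# < x → 0# < y → 0# < x * y
    0≉1                : 0# ≉ 1#
    _⁻¹                : Carrier → Carrier
    ⁻¹-inverseʳ        : ∀ {x} → x ≉ 0# → x * x ⁻¹ ≈ 1#

  _≤_ : Rel Carrier (ℓ₁ ⊔ ℓ₂)
  _≤_ = StrictToNonStrict._≤_ _≈_ _<_

  open RawMonoidDefinitions +-rawMonoid public using (sum)

  fromℕ : ℕ → Carrier
  fromℕ m = RawMonoidDefinitions._×_ +-rawMonoid m 1#

-- Clusterings of Fin n.  The state of the interactive process is the list of
-- clusters alone; clusterings are compared up to the order of that list.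

record Clustering (n : ℕ) : Set where
  field
    clusters : List (Subset n)
    nonempty : All Nonempty clusters
    disjoint : AllPairs (λ A B → Empty (A ∩ B)) clusters
    cover    : ∀ x → Any (x ∈_) clusters

open Clustering public

sameCluster : List (Subset n) → Fin n → Fin n → Bool
sameCluster D u v = does (any? (λ A → (u ∈? A) ×-dec (v ∈? A)) D)

δcc : Clustering n → Clustering n → ℕ
δcc {n} C C* = length (filter
  (λ (u , v) → ¬? (sameCluster (clusters C) u v Bool.≟ sameCluster (clusters C*) u v))
  (cartesianProduct (allFin n) (allFin n)))

data Tree (n : ℕ) : Set where
  leaf : Fin n → Tree n
  node : Tree n → Tree n → Tree n

points : Tree n → Subset n
points (leaf x)   = ⁅ x ⁆
points (node l r) = points l ∪ points r

-- NodeAt T d N : the subtree N is rooted at a node of T of depth d.  A node is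
-- identified with the subtree below it, so that its children are at hand.
data NodeAt {n} : Tree n → ℕ → Tree n → Set where
  here  : ∀ {T} → NodeAt T 0 T
  left  : ∀ {l r d N} → NodeAt l d N → NodeAt (node l r) (ℕ.suc d) N
  right : ∀ {l r d N} → NodeAt r d N → NodeAt (node l r) (ℕ.suc d) N

Deepest : ∀ {p} → Tree n → (Subset n → Set p) → Tree n → Set p
Deepest T P N = ∃ λ d → NodeAt T d N × P (points N) ×
  (∀ {d′ N′} → NodeAt T d′ N′ → P (points N′) → d′ ℕ.≤ d)

module _ (F : OrderedField c ℓ₁ ℓ₂) where
  open OrderedField F hiding (_≤_; _<_)
  open OrderedField F using (_≤_; _<_)

  module _ {n : ℕ} (S : Fin n → Fin n → Carrier) where

    sumOver : Subset n → (Fin n → Carrier) → Carrier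
    sumOver A f = sum (λ x → if lookup A x then f x else 0#)

    average : Subset n → Subset n → Carrier
    average A A′ =
      sumOver A (λ x → sumOver A′ (λ y → S x y)) * fromℕ (∣ A ∣ ℕ.* ∣ A′ ∣) ⁻¹

    Stable : Clustering n → Set ℓ₂
    Stable C* = ∀ {C C′} → C List.∈ clusters C* → C′ List.∈ clusters C* → C ≢ C′ →
      ∀ {A A′} → Nonempty A → A ⊂ C → Nonempty A′ → A′ ⊆ C′ →
      average A A′ < average A (C ─ A)

    -- One agglomeration step on the forest of current nodes.
    data _⇒_ (G : List (Tree n)) : List (Tree n) → Set (ℓ₁ ⊔ ℓ₂) where
      link : ∀ {N₁ N₂ R} → G ↭ N₁ ∷ N₂ ∷ R →
             (∀ {M₁ M₂ R′} → G ↭ M₁ ∷ M₂ ∷ R′ →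
               average (points M₁) (points M₂) ≤ average (points N₁) (points N₂)) →
             G ⇒ (node N₁ N₂ ∷ R)

    IsAverageLinkageTree : Tree n → Set (ℓ₁ ⊔ ℓ₂)
    IsAverageLinkageTree T = Star _⇒_ (map leaf (allFin n)) (T ∷ [])

  module _ {n : ℕ} (T : Tree n) (C* : Clustering n) (η : Carrier) where

    ContainsFraction : Subset n → Subset n → Set (ℓ₁ ⊔ ℓ₂)
    ContainsFraction A P = η * fromℕ ∣ A ∣ ≤ fromℕ ∣ P ∩ A ∣

    SplitAllowed : Subset n → Set
    SplitAllowed A = ∃₂ λ C C′ → C List.∈ clusters C* × C′ List.∈ clusters C* × C ≢ C′ ×
      Nonempty (A ∩ C) × Nonempty (A ∩ C′)

    MergeAllowed : Subset n → Subset n → Set (ℓ₁ ⊔ ℓ₂)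
    MergeAllowed A B = ∃ λ C → C List.∈ clusters C* ×
      ContainsFraction A C × ContainsFraction B C

    MergeNode : Subset n → Subset n → Tree n → Set (ℓ₁ ⊔ ℓ₂)
    MergeNode A B = Deepest T (λ P → ContainsFraction A P × ContainsFraction B P)

    data Edit (D : List (Subset n)) : List (Subset n) → Set (ℓ₁ ⊔ ℓ₂) where
      split  : ∀ {A R N₁ N₂} → D ↭ A ∷ R → SplitAllowed A →
               Deepest T (A ⊆_) (node N₁ N₂) →
               Edit D ((A ∩ points N₁) ∷ (A ∩ points N₂) ∷ R)
      mergeˡ : ∀ {A B R N} → D ↭ A ∷ B ∷ R → MergeAllowed A B → MergeNode A B N →
               ∣ B ∣ ℕ.≤ ∣ A ∣ →
               Edit D (filter nonempty?
                 ((A ∪ (points N ∩ B)) ∷ (B ─ points N) ∷ []) ++ R)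
      mergeʳ : ∀ {A B R N} → D ↭ A ∷ B ∷ R → MergeAllowed A B → MergeNode A B N →
               ∣ A ∣ ℕ.< ∣ B ∣ →
               Edit D (filter nonempty?
                 ((A ─ points N) ∷ (B ∪ (points N ∩ A)) ∷ []) ++ R)

    data Edits (D : List (Subset n)) : ℕ → List (Subset n) → Set (ℓ₁ ⊔ ℓ₂) where
      done : Edits D 0 D
      _▷_  : ∀ {m D′ D″} → Edits D m D′ → Edit D′ D″ → Edits D (ℕ.suc m) D″

-- Stability makes every node of the average-linkage tree laminar with respect to
-- the target: it is contained in, contains, or misses each target cluster.
-- Hence a split never separates two points of one target cluster, and the node
-- used by a merge lies inside the target cluster C that witnesses the request.
-- So each request decreases the error.  This is clear for a split.  A merge
-- moves the points P of B to A, where ∣ B ∣ ≤ ∣ A ∣; each moved point loses at most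
-- ∣ A ─ C ∣ + ∣ B ─ P ∣ and gains at least ∣ A ∩ C ∣ correct pairs, and the latter is
-- larger because A ∩ C and P make up more than two thirds of A and B.
module Submission where

open import Defs
open import Data.Bool.Base using (Bool; true; false; _∧_; not; if_then_else_)
import Data.Bool.Properties as Bool
open import Data.Empty using (⊥-elim)
open import Data.Fin.Base as Fin using (Fin)
open import Data.Fin.Subset using
  ( Subset; inside; outside; ⁅_⁆; _∈_; _∉_; _⊆_; _⊂_; _∩_; _∪_; _─_; ∣_∣
  ; Nonempty; Empty )
open import Data.Fin.Subset.Properties using
  ( _∈?_; _⊆?_; nonempty?; ⊆-antisym; p⊆q⇒∣p∣≤∣q∣; x∈⁅x⁆; x∈⁅y⁆⇒x≡y; ∣⁅x⁆∣≡1
  ; p∩q⊆p; p∩q⊆q; x∈p∩q⁺; x∈p∩q⁻; ∩-comm; p⊆p∪q; q⊆p∪q; x∈p∪q⁻; p─q⊆p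
  ; x∈p∧x∉q⇒x∈p─q )
open import Data.List.Base using
  (List; []; _∷_; _++_; map; allFin; filter; length; cartesianProduct; tabulate)
import Data.List.Membership.Propositional as List
open import Data.List.Membership.Propositional.Properties using
  (∈-∃++; ∈-allFin; ∈-filter⁺; ∈-AllPairs₂)
open import Data.List.Membership.Propositional.Properties.WithK using (unique∧set⇒bag)
open import Data.List.Properties using
  (map-tabulate; map-++; map-∘; filter-++; filter-all)
open import Data.List.Relation.Binary.BagAndSetEquality using (∼bag⇒↭)
open import Data.List.Relation.Binary.Permutation.Propositional using
  (_↭_; ↭-refl; ↭-trans; ↭-sym; ↭-prep; ↭-swap; ↭⇒↭ₛ)
open import Data.List.Relation.Binary.Permutation.Propositional.Properties using
  (shift; shifts; map⁺; All-resp-↭; Any-resp-↭)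
import Data.List.Relation.Binary.Permutation.Setoid.Properties as PermutationSetoid
open import Data.List.Relation.Unary.All as All using (All; []; _∷_)
import Data.List.Relation.Unary.All.Properties as All
open import Data.List.Relation.Unary.AllPairs as AllPairs using (AllPairs; []; _∷_)
import Data.List.Relation.Unary.AllPairs.Properties as AllPairs
open import Data.List.Relation.Unary.Any as Any using (Any; here; there; any?)
import Data.List.Relation.Unary.Any.Properties as Any
open import Data.List.Relation.Unary.Unique.Propositional using (Unique)
open import Data.List.Relation.Unary.Unique.Propositional.Properties using (allFin⁺)
open import Data.Nat.Base as ℕ using (ℕ)
import Data.Nat.Properties as ℕₚ
open import Data.Nat.Tactic.RingSolver using (solve-∀)
open import Data.Product.Base as Product using (_×_; _,_; proj₁; proj₂; ∃; ∃₂)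
open import Data.Sum.Base as Sum using (_⊎_; inj₁; inj₂; [_,_]′)
open import Data.Vec.Base as Vec using ([]; _∷_; lookup)
open import Data.Vec.Properties using (lookup⇒[]=)
open import Function.Base using (_∘_; id)
open import Function.Bundles using (_⇔_; mk⇔; Equivalence)
open import Level using (Level)
open import Relation.Binary.Bundles using (StrictPartialOrder)
open import Relation.Binary.Construct.Closure.ReflexiveTransitive using (Star; ε; _◅_)
import Relation.Binary.Construct.StrictToNonStrict as StrictToNonStrict
open import Relation.Binary.Definitions using (Decidable; tri<; tri≈; tri>)
open import Relation.Binary.PropositionalEquality as ≡ using (_≡_; _≢_)
import Relation.Binary.Reasoning.StrictPartialOrder as StrictPartialOrderReasoning
open import Relation.Binary.Structures using (IsStrictTotalOrder)
open import Relation.Nullary using (¬_; Dec; yes; no; contradiction; does)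
open import Relation.Nullary.Decidable using
  (dec-true; dec-false; does-⇔; _×-dec_; ¬?)
import Algebra.Properties.Ring as RingProperties
import Algebra.Properties.Semiring.Mult as SemiringMult
import Algebra.Properties.Semiring.Sum as SemiringSum

-- Linking two nodes can break laminarity with a target cluster `C` in only one way: a node `P`
-- properly inside `C` is joined to a node `Q` that misses `C`. The rest `C ─ P` then consists of
-- whole current nodes, so the maximality of the link bounds its average similarity to `P` by that
-- of `Q`. Stability says the opposite, but only for subsets of a single other cluster, while `Q`
-- may span several. Averages do not add up over pieces, so each is replaced by a sum compared with
-- the sum of a constant; such inequalities add up over any partition. Counting requests gives the
-- bound, but not that a run which cannot continue has reached the target. The second conclusion
-- supplies this: away from the target some request is always allowed. It assumes `η ≤ 1#`, because
-- for larger `η` no merge of nonempty clusters is ever allowed.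

private variable
  a c ℓ₁ ℓ₂ p r : Level
  I : Set a
  n d : ℕ
  L : List (Subset n)
  T N : Tree n

-- Ordered fields

module OrderedFieldProperties (F : OrderedField c ℓ₁ ℓ₂) where
  open OrderedField F
  open IsStrictTotalOrder isStrictTotalOrder
    using (isStrictPartialOrder; compare; irrefl; asym; <-respʳ-≈)
  open RingProperties ring using (-‿distribˡ-*; -‿involutive)
  open SemiringMult semiring using (×1-homo-*)

  strictPartialOrder : StrictPartialOrder _ _ _
  strictPartialOrder = record { isStrictPartialOrder = isStrictPartialOrder }

  module ≤-Reasoning = StrictPartialOrderReasoning strictPartialOrder
  open ≤-Reasoning

  infix 4 _≤?_
  _≤?_ : Decidable _≤_
  _≤?_ = StrictToNonStrict.decidable′ _≈_ _<_ compare

  ≤-refl : ∀ {x} → x ≤ x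
  ≤-refl = inj₂ refl

  <⇒≱ : ∀ {x y} → x < y → ¬ y ≤ x
  <⇒≱ x<y (inj₁ y<x) = asym x<y y<x
  <⇒≱ x<y (inj₂ y≈x) = irrefl (sym y≈x) x<y

  ≮⇒≥ : ∀ {x y} → ¬ x < y → y ≤ x
  ≮⇒≥ {x} {y} x≮y with compare x y
  ... | tri< x<y _ _ = contradiction x<y x≮y
  ... | tri≈ _ x≈y _ = inj₂ (sym x≈y)
  ... | tri> _ _ y<x = inj₁ y<x

  +-monoʳ-≤ : ∀ x {y z} → y ≤ z → x + y ≤ x + z
  +-monoʳ-≤ x (inj₁ y<z) = inj₁ (+-monoʳ-< x y<z)
  +-monoʳ-≤ x (inj₂ y≈z) = inj₂ (+-congˡ y≈z)

  +-monoˡ-< : ∀ x {y z} → y < z → y + x < z + x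
  +-monoˡ-< x {y} {z} y<z = begin-strict
    y + x  ≈⟨ +-comm y x ⟩
    x + y  <⟨ +-monoʳ-< x y<z ⟩
    x + z  ≈⟨ +-comm x z ⟩
    z + x  ∎

  +-mono-<-≤ : ∀ {x y u v} → x < y → u ≤ v → x + u < y + v
  +-mono-<-≤ {x} {y} {u} {v} x<y u≤v = begin-strict
    x + u  <⟨ +-monoˡ-< u x<y ⟩
    y + u  ≤⟨ +-monoʳ-≤ y u≤v ⟩
    y + v  ∎

  +-mono-≤ : ∀ {x y u v} → x ≤ y → u ≤ v → x + u ≤ y + v
  +-mono-≤ (inj₁ x<y) u≤v = inj₁ (+-mono-<-≤ x<y u≤v)
  +-mono-≤ {x} {y} {u} {v} (inj₂ x≈y) u≤v = begin
    x + u  ≈⟨ +-congʳ x≈y ⟩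
    y + u  ≤⟨ +-monoʳ-≤ y u≤v ⟩
    y + v  ∎

  x<y⇒0<y-x : ∀ {x y} → x < y → 0# < y - x
  x<y⇒0<y-x {x} {y} x<y = begin-strict
    0#     ≈⟨ -‿inverseʳ x ⟨
    x - x  <⟨ +-monoˡ-< (- x) x<y ⟩
    y - x  ∎

  *-monoˡ-< : ∀ {x y z} → 0# < z → x < y → x * z < y * z
  *-monoˡ-< {x} {y} {z} 0<z x<y = begin-strict
    x * z                    ≈⟨ +-identityˡ _ ⟨
    0# + x * z               <⟨ +-monoˡ-< (x * z) (*-pos (x<y⇒0<y-x x<y) 0<z) ⟩
    (y - x) * z + x * z      ≈⟨ distribʳ z (y - x) x ⟨
    (y - x + x) * z          ≈⟨ *-congʳ (+-assoc y (- x) x) ⟩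
    (y + (- x + x)) * z      ≈⟨ *-congʳ (+-congˡ (-‿inverseˡ x)) ⟩
    (y + 0#) * z             ≈⟨ *-congʳ (+-identityʳ y) ⟩
    y * z                    ∎

  *-monoˡ-≤ : ∀ {x y z} → 0# < z → x ≤ y → x * z ≤ y * z
  *-monoˡ-≤ 0<z (inj₁ x<y) = inj₁ (*-monoˡ-< 0<z x<y)
  *-monoˡ-≤ 0<z (inj₂ x≈y) = inj₂ (*-congʳ x≈y)

  *-cancelʳ-≤ : ∀ {x y z} → 0# < z → x * z ≤ y * z → x ≤ y
  *-cancelʳ-≤ 0<z xz≤yz = ≮⇒≥ λ y<x → <⇒≱ (*-monoˡ-< 0<z y<x) xz≤yz

  -- The axioms give only `0# ≉ 1#`. If `1#` were negative, `- 1#` would be positive, and its square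
  -- is `1#`.
  0<1 : 0# < 1#
  0<1 with compare 0# 1#
  ... | tri< 0<1 _ _ = 0<1
  ... | tri≈ _ 0≈1 _ = contradiction 0≈1 0≉1
  ... | tri> _ _ 1<0 = begin-strict
    0#                 <⟨ *-pos 0<-1 0<-1 ⟩
    (- 1#) * (- 1#)    ≈⟨ -‿distribˡ-* 1# (- 1#) ⟨
    - (1# * (- 1#))    ≈⟨ -‿cong (*-identityˡ _) ⟩
    - (- 1#)           ≈⟨ -‿involutive 1# ⟩
    1#                 ∎
    where
    0<-1 : 0# < - 1#
    0<-1 = <-respʳ-≈ (+-identityˡ _) (x<y⇒0<y-x 1<0)

  fromℕ-nonneg : ∀ m → 0# ≤ fromℕ m
  fromℕ-nonneg ℕ.zero    = ≤-refl
  fromℕ-nonneg (ℕ.suc m) = begin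
    0#            ≈⟨ +-identityˡ 0# ⟨
    0# + 0#       ≤⟨ +-mono-≤ (inj₁ 0<1) (fromℕ-nonneg m) ⟩
    1# + fromℕ m  ∎

  fromℕ-pos : ∀ {m} → 0 ℕ.< m → 0# < fromℕ m
  fromℕ-pos {ℕ.suc m} _ = begin-strict
    0#            ≈⟨ +-identityˡ 0# ⟨
    0# + 0#       <⟨ +-mono-<-≤ 0<1 (fromℕ-nonneg m) ⟩
    1# + fromℕ m  ∎

  fromℕ-mono-≤ : ∀ {m n} → m ℕ.≤ n → fromℕ m ≤ fromℕ n
  fromℕ-mono-≤ {n = n} ℕ.z≤n = fromℕ-nonneg n
  fromℕ-mono-≤ (ℕ.s≤s m≤n)   = +-monoʳ-≤ 1# (fromℕ-mono-≤ m≤n)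

  fromℕ-cancel-< : ∀ {m n} → fromℕ m < fromℕ n → m ℕ.< n
  fromℕ-cancel-< fm<fn = ℕₚ.≰⇒> λ n≤m → <⇒≱ fm<fn (fromℕ-mono-≤ n≤m)

  fromℕ-* : ∀ m n → fromℕ (m ℕ.* n) ≈ fromℕ m * fromℕ n
  fromℕ-* = ×1-homo-*

  -- Moves the threshold from the field to natural numbers, where all the counting takes place.
  -- Strictness survives because `l` is positive.
  two-thirds-< : ∀ {η} → fromℕ 2 * fromℕ 3 ⁻¹ < η → ∀ k {l} → 0 ℕ.< l →
                 η * fromℕ l ≤ fromℕ k → 2 ℕ.* l ℕ.< k ℕ.* 3
  two-thirds-< {η} 2/3<η k {l} 0<l ηl≤k = fromℕ-cancel-< (begin-strict
    fromℕ (2 ℕ.* l)                                  ≈⟨ fromℕ-* 2 l ⟩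
    fromℕ 2 * fromℕ l                                ≈⟨ *-congʳ 2≈2/3*3 ⟩
    (fromℕ 2 * fromℕ 3 ⁻¹ * fromℕ 3) * fromℕ l       <⟨ *-monoˡ-< (fromℕ-pos 0<l) (*-monoˡ-< 0<3 2/3<η) ⟩
    (η * fromℕ 3) * fromℕ l                          ≈⟨ *-assoc η _ _ ⟩
    η * (fromℕ 3 * fromℕ l)                          ≈⟨ *-congˡ (*-comm _ _) ⟩
    η * (fromℕ l * fromℕ 3)                          ≈⟨ *-assoc η _ _ ⟨
    (η * fromℕ l) * fromℕ 3                          ≤⟨ *-monoˡ-≤ 0<3 ηl≤k ⟩
    fromℕ k * fromℕ 3                                ≈⟨ fromℕ-* k 3 ⟨
    fromℕ (k ℕ.* 3)                                  ∎)
    where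
    0<3 : 0# < fromℕ 3
    0<3 = fromℕ-pos {3} (ℕ.s≤s ℕ.z≤n)
    2≈2/3*3 : fromℕ 2 ≈ fromℕ 2 * fromℕ 3 ⁻¹ * fromℕ 3
    2≈2/3*3 = begin-equality
      fromℕ 2                            ≈⟨ *-identityʳ _ ⟨
      fromℕ 2 * 1#                       ≈⟨ *-congˡ (⁻¹-inverseʳ λ 3≈0 → irrefl (sym 3≈0) 0<3) ⟨
      fromℕ 2 * (fromℕ 3 * fromℕ 3 ⁻¹)   ≈⟨ *-congˡ (*-comm _ _) ⟩
      fromℕ 2 * (fromℕ 3 ⁻¹ * fromℕ 3)   ≈⟨ *-assoc _ _ _ ⟨
      fromℕ 2 * fromℕ 3 ⁻¹ * fromℕ 3     ∎

-- Sums and averages over subsets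

Disjoint : Subset n → Subset n → Set
Disjoint A B = Empty (A ∩ B)

Disjoint-sym : {A B : Subset n} → Disjoint A B → Disjoint B A
Disjoint-sym {A = A} {B} A∥B (x , x∈) = let x∈B , x∈A = x∈p∩q⁻ B A x∈ in A∥B (x , x∈p∩q⁺ (x∈A , x∈B))

x∈p─q⁻ : (A B : Subset n) {x : Fin n} → x ∈ A ─ B → x ∈ A × x ∉ B
x∈p─q⁻ A B x∈A─B = p─q⊆p A B x∈A─B , λ x∈B →
  contradiction x∈A─B (x∉p─q A B x∈B)
  where
  x∉p─q : ∀ {n} {x : Fin n} (A B : Subset n) → x ∈ B → x ∉ A ─ B
  x∉p─q {x = Fin.zero}  (_ ∷ A) (inside ∷ B)  _       ()
  x∉p─q {x = Fin.zero}  (_ ∷ A) (outside ∷ B) ()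
  x∉p─q {x = Fin.suc x} (_ ∷ A) (_ ∷ B) (Vec.there x∈B) (Vec.there x∈A─B) = x∉p─q A B x∈B x∈A─B

nonempty⇒0<∣p∣ : {A : Subset n} → Nonempty A → 0 ℕ.< ∣ A ∣
nonempty⇒0<∣p∣ {A = A} (x , x∈A) = ≡.subst (ℕ._≤ ∣ A ∣) (∣⁅x⁆∣≡1 x)
  (p⊆q⇒∣p∣≤∣q∣ λ y∈ → ≡.subst (_∈ A) (≡.sym (x∈⁅y⁆⇒x≡y x y∈)) x∈A)

disjoint⇒─∩≡∩ : (A B C : Subset n) → Disjoint A C → (B ─ A) ∩ C ≡ B ∩ C
disjoint⇒─∩≡∩ A B C A∥C = ⊆-antisym
  (λ x∈ → let x∈B─A , x∈C = x∈p∩q⁻ (B ─ A) C x∈ in x∈p∩q⁺ (p─q⊆p B A x∈B─A , x∈C))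
  (λ {x} x∈ → let x∈B , x∈C = x∈p∩q⁻ B C x∈ in
    x∈p∩q⁺ (x∈p∧x∉q⇒x∈p─q x∈B (λ x∈A → A∥C (x , x∈p∩q⁺ (x∈A , x∈C))) , x∈C))

module SumOver (F : OrderedField c ℓ₁ ℓ₂) {n : ℕ} (S : Fin n → Fin n → OrderedField.Carrier F) where
  open OrderedField F
  open IsStrictTotalOrder isStrictTotalOrder using (irrefl)
  open OrderedFieldProperties F
  open ≤-Reasoning
  open SemiringSum semiring
    using (sum-cong-≋; sum-replicate-zero; ∑-distrib-+; ∑-comm; *-distribʳ-sum)

  ∑ : Subset n → (Fin n → Carrier) → Carrier
  ∑ = sumOver F S

  avg : Subset n → Subset n → Carrier
  avg = average F S

  ∑-split : ∀ A B f → ∑ A f ≈ ∑ (A ∩ B) f + ∑ (A ─ B) f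
  ∑-split A B f = begin-equality
    ∑ A f                        ≈⟨ sum-cong-≋ (pointwise A B f) ⟩
    sum (λ x → (if lookup (A ∩ B) x then f x else 0#)
             + (if lookup (A ─ B) x then f x else 0#))
                                 ≈⟨ ∑-distrib-+ {n} _ _ ⟩
    ∑ (A ∩ B) f + ∑ (A ─ B) f    ∎
    where
    pointwise : ∀ {m} (A B : Subset m) (f : Fin m → Carrier) x →
      (if lookup A x then f x else 0#) ≈
      (if lookup (A ∩ B) x then f x else 0#) + (if lookup (A ─ B) x then f x else 0#)
    pointwise (inside  ∷ A) (inside  ∷ B) f Fin.zero = sym (+-identityʳ _)
    pointwise (inside  ∷ A) (outside ∷ B) f Fin.zero = sym (+-identityˡ _)
    pointwise (outside ∷ A) (inside  ∷ B) f Fin.zero = sym (+-identityˡ _)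
    pointwise (outside ∷ A) (outside ∷ B) f Fin.zero = sym (+-identityˡ _)
    pointwise (_ ∷ A) (_ ∷ B) f (Fin.suc x) = pointwise A B (λ y → f (Fin.suc y)) x

  ∑-empty : ∀ {A} f → Empty A → ∑ A f ≈ 0#
  ∑-empty {A} f ∅ = trans (sum-cong-≋ zeros) (sum-replicate-zero n)
    where
    zeros : ∀ x → (if lookup A x then f x else 0#) ≈ 0#
    zeros x with lookup A x in eq
    ... | true  = contradiction (x , lookup⇒[]= x A eq) ∅
    ... | false = refl

  ∑-const : ∀ A k → ∑ A (λ _ → k) ≈ fromℕ ∣ A ∣ * k
  ∑-const = go
    where
    go : ∀ {m} (A : Subset m) k → sum (λ x → if lookup A x then k else 0#) ≈ fromℕ ∣ A ∣ * k
    go []            k = sym (zeroˡ k)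
    go (outside ∷ A) k = trans (+-identityˡ _) (go A k)
    go (inside  ∷ A) k = begin-equality
      k + sum (λ x → if lookup A x then k else 0#)  ≈⟨ +-cong (sym (*-identityˡ k)) (go A k) ⟩
      1# * k + fromℕ ∣ A ∣ * k                      ≈⟨ distribʳ k 1# _ ⟨
      (1# + fromℕ ∣ A ∣) * k                        ∎

  ∑-swap : ∀ A B (f : Fin n → Fin n → Carrier) →
           ∑ A (λ x → ∑ B (f x)) ≈ ∑ B (λ y → ∑ A (λ x → f x y))
  ∑-swap A B f = begin-equality
    ∑ A (λ x → ∑ B (f x))
      ≈⟨ sum-cong-≋ (λ x → if-sum (lookup A x) _) ⟩
    sum (λ x → sum (λ y → if lookup A x then if lookup B y then f x y else 0# else 0#))
      ≈⟨ ∑-comm (λ x y → if lookup A x then if lookup B y then f x y else 0# else 0#) ⟩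
    sum (λ y → sum (λ x → if lookup A x then if lookup B y then f x y else 0# else 0#))
      ≈⟨ sum-cong-≋ (λ y → sum-cong-≋ λ x → if-comm (lookup A x) (lookup B y)) ⟩
    sum (λ y → sum (λ x → if lookup B y then if lookup A x then f x y else 0# else 0#))
      ≈⟨ sum-cong-≋ (λ y → if-sum (lookup B y) _) ⟨
    ∑ B (λ y → ∑ A (λ x → f x y))  ∎
    where
    if-sum : ∀ b (g : Fin n → Carrier) →
             (if b then sum g else 0#) ≈ sum (λ y → if b then g y else 0#)
    if-sum true  g = refl
    if-sum false g = sym (sum-replicate-zero n)
    if-comm : ∀ a b {k : Carrier} →
              (if a then if b then k else 0# else 0#) ≈ (if b then if a then k else 0# else 0#)
    if-comm true  true  = refl
    if-comm true  false = refl
    if-comm false true  = refl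
    if-comm false false = refl

  ∑-cong : ∀ A {f g : Fin n → Carrier} → (∀ x → f x ≈ g x) → ∑ A f ≈ ∑ A g
  ∑-cong A {f} {g} f≈g = sum-cong-≋ λ x → if-cong (lookup A x) x
    where
    if-cong : ∀ b x → (if b then f x else 0#) ≈ (if b then g x else 0#)
    if-cong true  x = f≈g x
    if-cong false x = refl

  -- Blocks are peeled off one at a time: removing `A` from `B` does not change the traces of `B` on
  -- the blocks disjoint from `A`.
  ∑-mono-≤-blocks : ∀ L → AllPairs Disjoint L → ∀ {B f g} → (∀ {x} → x ∈ B → Any (x ∈_) L) →
    All (λ A → ∑ (B ∩ A) f ≤ ∑ (B ∩ A) g) L → ∑ B f ≤ ∑ B g
  ∑-mono-≤-blocks [] _ {B} {f} {g} B⊆⋃ _ = begin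
    ∑ B f  ≈⟨ ∑-empty f ∅ ⟩
    0#     ≈⟨ ∑-empty g ∅ ⟨
    ∑ B g  ∎
    where
    ∅ : Empty B
    ∅ (x , x∈B) with () ← B⊆⋃ x∈B
  ∑-mono-≤-blocks (A ∷ L) (A∥L ∷ L∥) {B} {f} {g} B⊆⋃ (f≤g ∷ fs≤gs) = begin
    ∑ B f                        ≈⟨ ∑-split B A f ⟩
    ∑ (B ∩ A) f + ∑ (B ─ A) f    ≤⟨ +-mono-≤ f≤g (∑-mono-≤-blocks L L∥ covered
                                     (All.zipWith on-rest (A∥L , fs≤gs))) ⟩
    ∑ (B ∩ A) g + ∑ (B ─ A) g    ≈⟨ ∑-split B A g ⟨
    ∑ B g                        ∎
    where
    covered : ∀ {x} → x ∈ B ─ A → Any (x ∈_) L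
    covered x∈B─A with x∈p─q⁻ B A x∈B─A
    ... | x∈B , x∉A with B⊆⋃ x∈B
    ...   | here x∈A  = contradiction x∈A x∉A
    ...   | there x∈L = x∈L
    on-rest : ∀ {A′} → Disjoint A A′ × ∑ (B ∩ A′) f ≤ ∑ (B ∩ A′) g →
              ∑ ((B ─ A) ∩ A′) f ≤ ∑ ((B ─ A) ∩ A′) g
    on-rest {A′} (A∥A′ , f≤g) rewrite disjoint⇒─∩≡∩ A B A′ A∥A′ = f≤g

  -- avg A B ≤ s says that the sum over B of the similarity to A is at most the
  -- sum over B of the constant s ∣A∣, and such comparisons add up over the
  -- blocks of a partition of B.
  similarityTo : Subset n → Fin n → Carrier
  similarityTo A y = ∑ A (λ x → S x y)

  pairs-pos : (A B : Subset n) → Nonempty A → Nonempty B → 0# < fromℕ (∣ A ∣ ℕ.* ∣ B ∣)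
  pairs-pos A B A≠∅ B≠∅ = fromℕ-pos {∣ A ∣ ℕ.* ∣ B ∣} (ℕₚ.*-mono-< (nonempty⇒0<∣p∣ A≠∅) (nonempty⇒0<∣p∣ B≠∅))

  -- Nonemptiness makes the number of pairs invertible; at `0#` the inverse is unspecified, and the
  -- average says nothing about the sum.
  ∑-similarityTo : ∀ A B → Nonempty A → Nonempty B →
    ∑ B (similarityTo A) ≈ avg A B * fromℕ (∣ A ∣ ℕ.* ∣ B ∣)
  ∑-similarityTo A B A≠∅ B≠∅ = begin-equality
    ∑ B (similarityTo A)     ≈⟨ ∑-swap A B S ⟨
    W                        ≈⟨ *-identityʳ W ⟨
    W * 1#                   ≈⟨ *-congˡ (⁻¹-inverseʳ λ k≈0 → irrefl (sym k≈0) (pairs-pos A B A≠∅ B≠∅)) ⟨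
    W * (k * k ⁻¹)           ≈⟨ *-congˡ (*-comm k _) ⟩
    W * (k ⁻¹ * k)           ≈⟨ *-assoc W _ _ ⟨
    avg A B * k              ∎
    where
    W = ∑ A (λ x → ∑ B (λ y → S x y))
    k = fromℕ (∣ A ∣ ℕ.* ∣ B ∣)

  ∑-threshold : (A B : Subset n) → ∀ s → ∑ B (λ _ → s * fromℕ ∣ A ∣) ≈ s * fromℕ (∣ A ∣ ℕ.* ∣ B ∣)
  ∑-threshold A B s = begin-equality
    ∑ B (λ _ → s * fromℕ ∣ A ∣)          ≈⟨ ∑-const B _ ⟩
    fromℕ ∣ B ∣ * (s * fromℕ ∣ A ∣)      ≈⟨ *-comm _ _ ⟩
    (s * fromℕ ∣ A ∣) * fromℕ ∣ B ∣      ≈⟨ *-assoc s _ _ ⟩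
    s * (fromℕ ∣ A ∣ * fromℕ ∣ B ∣)      ≈⟨ *-congˡ (fromℕ-* ∣ A ∣ ∣ B ∣) ⟨
    s * fromℕ (∣ A ∣ ℕ.* ∣ B ∣)          ∎

  avg-≤⇒∑-≤ : ∀ {A B s} → Nonempty A → Nonempty B → avg A B ≤ s →
    ∑ B (similarityTo A) ≤ ∑ B (λ _ → s * fromℕ ∣ A ∣)
  avg-≤⇒∑-≤ {A} {B} {s} A≠∅ B≠∅ avg≤s = begin
    ∑ B (similarityTo A)                 ≈⟨ ∑-similarityTo A B A≠∅ B≠∅ ⟩
    avg A B * fromℕ (∣ A ∣ ℕ.* ∣ B ∣)    ≤⟨ *-monoˡ-≤ (pairs-pos A B A≠∅ B≠∅) avg≤s ⟩
    s * fromℕ (∣ A ∣ ℕ.* ∣ B ∣)          ≈⟨ ∑-threshold A B s ⟨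
    ∑ B (λ _ → s * fromℕ ∣ A ∣)          ∎

  avg-<⇒∑-< : ∀ {A B s} → Nonempty A → Nonempty B → avg A B < s →
    ∑ B (similarityTo A) < ∑ B (λ _ → s * fromℕ ∣ A ∣)
  avg-<⇒∑-< {A} {B} {s} A≠∅ B≠∅ avg<s = begin-strict
    ∑ B (similarityTo A)                 ≈⟨ ∑-similarityTo A B A≠∅ B≠∅ ⟩
    avg A B * fromℕ (∣ A ∣ ℕ.* ∣ B ∣)    <⟨ *-monoˡ-< (pairs-pos A B A≠∅ B≠∅) avg<s ⟩
    s * fromℕ (∣ A ∣ ℕ.* ∣ B ∣)          ≈⟨ ∑-threshold A B s ⟨
    ∑ B (λ _ → s * fromℕ ∣ A ∣)          ∎

  ∑-≤⇒avg-≤ : ∀ {A B s} → Nonempty A → Nonempty B →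
    ∑ B (similarityTo A) ≤ ∑ B (λ _ → s * fromℕ ∣ A ∣) → avg A B ≤ s
  ∑-≤⇒avg-≤ {A} {B} {s} A≠∅ B≠∅ ∑≤ = *-cancelʳ-≤ (pairs-pos A B A≠∅ B≠∅) (begin
    avg A B * fromℕ (∣ A ∣ ℕ.* ∣ B ∣)    ≈⟨ ∑-similarityTo A B A≠∅ B≠∅ ⟨
    ∑ B (similarityTo A)                 ≤⟨ ∑≤ ⟩
    ∑ B (λ _ → s * fromℕ ∣ A ∣)          ≈⟨ ∑-threshold A B s ⟩
    s * fromℕ (∣ A ∣ ℕ.* ∣ B ∣)          ∎)

  avg-sym : (∀ x y → S x y ≈ S y x) → ∀ A B → avg A B ≈ avg B A
  avg-sym S-sym A B = *-cong
    (trans (∑-swap A B S) (∑-cong B λ y → ∑-cong A λ x → S-sym x y))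
    (reflexive (≡.cong (λ k → fromℕ k ⁻¹) (ℕₚ.*-comm ∣ A ∣ ∣ B ∣)))

-- Laminarity of average-linkage trees

∈⇒↭∷ : {A : Set a} {x : A} {xs : List A} → x List.∈ xs → ∃ λ ys → xs ↭ x ∷ ys
∈⇒↭∷ {x = x} x∈xs with ys , zs , ≡.refl ← ∈-∃++ x∈xs = ys ++ zs , shift x ys zs

AllPairs-disjoint-resp-↭ : {K L : List (Subset n)} → K ↭ L → AllPairs Disjoint K → AllPairs Disjoint L
AllPairs-disjoint-resp-↭ K↭L = PermutationSetoid.AllPairs-resp-↭ (≡.setoid _)
  (λ {A} {B} → Disjoint-sym {A = A} {B}) (≡.resp₂ Disjoint) (↭⇒↭ₛ K↭L)

Compatible : Subset n → Subset n → Set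
Compatible A C = A ⊆ C ⊎ C ⊆ A ⊎ Disjoint A C

-- A leaf carries no condition, since a singleton is compatible with every set. Disjointness of the
-- children is recorded because the two parts of a split inherit it.
data Laminar {n} (L : List (Subset n)) : Tree n → Set where
  leaf : ∀ x → Laminar L (leaf x)
  node : ∀ {l r} → Disjoint (points l) (points r) →
         All (Compatible (points l ∪ points r)) L →
         Laminar L l → Laminar L r → Laminar L (node l r)

laminar-at : Laminar L T → NodeAt T d N → Laminar L N
laminar-at T-lam            here      = T-lam
laminar-at (node _ _ ll _)  (left i)  = laminar-at ll i
laminar-at (node _ _ _ lr)  (right i) = laminar-at lr i

laminar⇒compatible : Laminar L T → All (Compatible (points T)) L
laminar⇒compatible (leaf x) = All.tabulate λ {C} _ → singleton C
  where
  singleton : ∀ C → Compatible ⁅ x ⁆ C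
  singleton C with x ∈? C
  ... | yes x∈C = inj₁ λ y∈ → ≡.subst (_∈ C) (≡.sym (x∈⁅y⁆⇒x≡y x y∈)) x∈C
  ... | no  x∉C = inj₂ (inj₂ λ (y , y∈) → let y∈x , y∈C = x∈p∩q⁻ ⁅ x ⁆ C y∈ in
    x∉C (≡.subst (_∈ C) (x∈⁅y⁆⇒x≡y x y∈x) y∈C))
laminar⇒compatible (node _ compatible _ _) = compatible

points-nonempty : (T : Tree n) → Nonempty (points T)
points-nonempty (leaf x)   = x , x∈⁅x⁆ x
points-nonempty (node l r) = let x , x∈l = points-nonempty l in x , p⊆p∪q (points r) x∈l

module _ (F : OrderedField c ℓ₁ ℓ₂) where
  open OrderedField F

  module _ {n : ℕ} (S : Fin n → Fin n → Carrier) (S-sym : ∀ x y → S x y ≈ S y x)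
    (target : Clustering n) (stable : Stable F S target) where
    open OrderedFieldProperties F
    open IsStrictTotalOrder isStrictTotalOrder using (irrefl)
    open SumOver F S

    -- C ─ P is a union of blocks M, and Q one of pieces of other clusters.  If
    -- avg P Q were the largest average, then avg P (C ─ P) ≤ avg P Q; but by
    -- stability every piece of Q, hence Q, is less similar to P than C ─ P is.
    no-partial-link : ∀ {P Q Ps C} → C List.∈ clusters target → P ⊂ C → Disjoint Q C →
      Nonempty P → Nonempty Q → All Nonempty Ps → AllPairs Disjoint (P ∷ Ps) →
      (∀ x → Any (x ∈_) (P ∷ Ps)) → All (λ M → Compatible M C) Ps →
      ¬ All (λ M → avg P M ≤ avg P Q) Ps
    no-partial-link {P} {Q} {Ps} {C} C∈ P⊂C@(P⊆C , z , z∈C , z∉P) Q∥C P≠∅ Q≠∅ Ps≠∅ (P∥Ps ∷ Ps∥)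
      ⋃Ps compatible maximal =
      -- Since `s` is the average of `P` and `Q` itself, the two sums over `Q` are equal; comparing
      -- them piece by piece makes one strictly smaller.
      irrefl (trans (∑-similarityTo P Q P≠∅ Q≠∅) (sym (∑-threshold P Q s))) (begin-strict
        ∑ Q f                          ≈⟨ ∑-split Q C₀ f ⟩
        ∑ (Q ∩ C₀) f + ∑ (Q ─ C₀) f
          <⟨ +-mono-<-≤ (piece-< C₀∈ (p∩q⊆p Q C₀) (p∩q⊆q Q C₀) (y , x∈p∩q⁺ (y∈Q , y∈C₀)))
               (∑-mono-≤-blocks (clusters target) (disjoint target) {Q ─ C₀} {f} {g}
                 (λ {x} _ → cover target x) (All.tabulate piece-≤)) ⟩
        ∑ (Q ∩ C₀) g + ∑ (Q ─ C₀) g    ≈⟨ ∑-split Q C₀ g ⟨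
        ∑ Q g                          ∎)
      where
      open ≤-Reasoning
      s = avg P Q
      f = similarityTo P
      g = λ (_ : Fin n) → s * fromℕ ∣ P ∣
      -- The piece of `Q` in the target cluster of `y` is nonempty and yields the strict inequality;
      -- the other pieces may be empty and yield only a weak one.
      y = proj₁ Q≠∅
      y∈Q = proj₂ Q≠∅
      C₀ = proj₁ (List.find (cover target y))
      C₀∈ = proj₁ (proj₂ (List.find (cover target y)))
      y∈C₀ = proj₂ (proj₂ (List.find (cover target y)))

      ∑-empty-≤ : ∀ {A} → Empty A → ∑ A f ≤ ∑ A g
      ∑-empty-≤ {A} ∅ = begin
        ∑ A f  ≈⟨ ∑-empty f ∅ ⟩
        0#     ≈⟨ ∑-empty g ∅ ⟨
        ∑ A g  ∎

      block : ∀ {M} → Compatible M C → Disjoint P M → Nonempty M → avg P M ≤ s →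
              ∑ ((C ─ P) ∩ M) f ≤ ∑ ((C ─ P) ∩ M) g
      block {M} (inj₁ M⊆C) P∥M M≠∅ avg≤s
        rewrite disjoint⇒─∩≡∩ P C M P∥M | ⊆-antisym (p∩q⊆q C M) (λ x∈M → x∈p∩q⁺ (M⊆C x∈M , x∈M))
        = avg-≤⇒∑-≤ P≠∅ M≠∅ avg≤s
      block (inj₂ (inj₁ C⊆M)) P∥M _ _ =
        contradiction (proj₁ P≠∅ , x∈p∩q⁺ (proj₂ P≠∅ , C⊆M (P⊆C (proj₂ P≠∅)))) P∥M
      block {M} (inj₂ (inj₂ M∥C)) _ _ _ = ∑-empty-≤ λ (x , x∈) →
        let x∈C─P , x∈M = x∈p∩q⁻ (C ─ P) M x∈ in M∥C (x , x∈p∩q⁺ (x∈M , p─q⊆p C P x∈C─P))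

      covered : ∀ {x} → x ∈ C ─ P → Any (x ∈_) Ps
      covered {x} x∈ with ⋃Ps x
      ... | here x∈P = contradiction x∈P (proj₂ (x∈p─q⁻ C P x∈))
      ... | there x∈Ps = x∈Ps

      t≤s : avg P (C ─ P) ≤ s
      t≤s = ∑-≤⇒avg-≤ P≠∅ (z , x∈p∧x∉q⇒x∈p─q z∈C z∉P) (∑-mono-≤-blocks Ps Ps∥ covered
        (All.tabulate λ M∈ → block (All.lookup compatible M∈) (All.lookup P∥Ps M∈)
          (All.lookup Ps≠∅ M∈) (All.lookup maximal M∈)))

      piece-< : ∀ {C′ A} → C′ List.∈ clusters target → A ⊆ Q → A ⊆ C′ → Nonempty A → ∑ A f < ∑ A g
      piece-< {C′} {A} C′∈ A⊆Q A⊆C′ A≠∅@(x , x∈A) = avg-<⇒∑-< P≠∅ A≠∅ (begin-strict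
        avg P A        <⟨ stable C∈ C′∈ C≢C′ P≠∅ P⊂C A≠∅ A⊆C′ ⟩
        avg P (C ─ P)  ≤⟨ t≤s ⟩
        s              ∎)
        where
        C≢C′ : C ≢ C′
        C≢C′ ≡.refl = Q∥C (x , x∈p∩q⁺ (A⊆Q x∈A , A⊆C′ x∈A))

      piece-≤ : ∀ {C′} → C′ List.∈ clusters target → ∑ ((Q ─ C₀) ∩ C′) f ≤ ∑ ((Q ─ C₀) ∩ C′) g
      piece-≤ {C′} C′∈ with nonempty? ((Q ─ C₀) ∩ C′)
      ... | yes A≠∅ = inj₁ (piece-< C′∈ (p─q⊆p Q C₀ ∘ p∩q⊆p (Q ─ C₀) C′) (p∩q⊆q (Q ─ C₀) C′) A≠∅)
      ... | no  ∅   = ∑-empty-≤ ∅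

    -- `covering` is what lets the maximality of a link control the whole of `C ─ P`: each of its
    -- points lies in some current node.
    record LaminarForest (G : List (Tree n)) : Set where
      field
        separated : AllPairs Disjoint (map points G)
        covering  : ∀ x → Any (x ∈_) (map points G)
        laminar   : All (Laminar (clusters target)) G
    open LaminarForest

    forest-resp-↭ : ∀ {G G′} → G ↭ G′ → LaminarForest G → LaminarForest G′
    forest-resp-↭ G↭G′ G-forest = record
      { separated = AllPairs-disjoint-resp-↭ (map⁺ points G↭G′) (separated G-forest)
      ; covering  = λ x → Any-resp-↭ (map⁺ points G↭G′) (covering G-forest x)
      ; laminar   = All-resp-↭ G↭G′ (laminar G-forest)
      }

    -- Maximality is assumed only among links that keep `N₁` as first node, so that the statement
    -- applies to either end of a link after a swap.
    linked-with-outside⇒⊇ : ∀ {N₁ N₂ R} → LaminarForest (N₁ ∷ N₂ ∷ R) →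
      (∀ {M R′} → N₁ ∷ N₂ ∷ R ↭ N₁ ∷ M ∷ R′ → avg (points N₁) (points M) ≤ avg (points N₁) (points N₂)) →
      ∀ {C} → C List.∈ clusters target → points N₁ ⊆ C → Disjoint (points N₂) C → C ⊆ points N₁
    linked-with-outside⇒⊇ {N₁} {N₂} {R} forest maximal {C} C∈ N₁⊆C N₂∥C {x} x∈C with x ∈? points N₁
    ... | yes x∈N₁ = x∈N₁
    ... | no  x∉N₁ = contradiction
      (All.map⁺ (All.tabulate λ M∈ → let _ , R↭ = ∈⇒↭∷ M∈ in maximal (↭-prep N₁ R↭)))
      (no-partial-link C∈ (N₁⊆C , x , x∈C , x∉N₁) N₂∥C (points-nonempty N₁) (points-nonempty N₂)
        (All.map⁺ (All.universal points-nonempty (N₂ ∷ R))) (separated forest) (covering forest)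
        (All.map⁺ (All.map (λ M-lam → All.lookup (laminar⇒compatible M-lam) C∈) (All.tail (laminar forest)))))

    ⇒-preserves-forest : ∀ {G G′} → LaminarForest G → _⇒_ F S G G′ → LaminarForest G′
    ⇒-preserves-forest {G} G-forest (link {N₁} {N₂} {R} G↭ maximal) = record
      { separated = All.zipWith (λ {M} (N₁∥M , N₂∥M) (x , x∈) →
                      let x∈N , x∈M = x∈p∩q⁻ (points N₁ ∪ points N₂) M x∈ in
                      ∪-disjoint {M} N₁∥M N₂∥M x∈N x∈M) (N₁∥R , N₂∥R) ∷ R∥
      ; covering  = λ x → regroup (covering forest x)
      ; laminar   = node N₁∥N₂ (All.tabulate λ C∈ → compatible C∈
                      (All.lookup (laminar⇒compatible N₁-lam) C∈) (All.lookup (laminar⇒compatible N₂-lam) C∈))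
                      N₁-lam N₂-lam ∷ R-lam
      }
      where
      forest : LaminarForest (N₁ ∷ N₂ ∷ R)
      forest = forest-resp-↭ G↭ G-forest
      open ≤-Reasoning
      N₁-lam = All.head (laminar forest)
      N₂-lam = All.head (All.tail (laminar forest))
      R-lam  = All.tail (All.tail (laminar forest))
      N₁∥N₂ = All.head (AllPairs.head (separated forest))
      N₁∥R = All.tail (AllPairs.head (separated forest))
      N₂∥R = AllPairs.head (AllPairs.tail (separated forest))
      R∥   = AllPairs.tail (AllPairs.tail (separated forest))

      ∪-disjoint : ∀ {M} → Disjoint (points N₁) M → Disjoint (points N₂) M →
                   ∀ {x} → x ∈ points N₁ ∪ points N₂ → ¬ x ∈ M
      ∪-disjoint N₁∥M N₂∥M {x} x∈N x∈M with x∈p∪q⁻ (points N₁) (points N₂) x∈N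
      ... | inj₁ x∈N₁ = N₁∥M (x , x∈p∩q⁺ (x∈N₁ , x∈M))
      ... | inj₂ x∈N₂ = N₂∥M (x , x∈p∩q⁺ (x∈N₂ , x∈M))

      regroup : ∀ {x} → Any (x ∈_) (map points (N₁ ∷ N₂ ∷ R)) → Any (x ∈_) (map points (node N₁ N₂ ∷ R))
      regroup (here x∈N₁)          = here (p⊆p∪q (points N₂) x∈N₁)
      regroup (there (here x∈N₂))  = here (q⊆p∪q (points N₁) (points N₂) x∈N₂)
      regroup (there (there x∈R))  = there x∈R

      C⊆N₁ : ∀ {C} → C List.∈ clusters target → points N₁ ⊆ C → Disjoint (points N₂) C → C ⊆ points N₁
      C⊆N₁ = linked-with-outside⇒⊇ forest λ G↭′ → maximal (↭-trans G↭ G↭′)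

      N₂N₁R↭ = ↭-swap N₁ N₂ (↭-refl {x = R})

      C⊆N₂ : ∀ {C} → C List.∈ clusters target → points N₂ ⊆ C → Disjoint (points N₁) C → C ⊆ points N₂
      C⊆N₂ = linked-with-outside⇒⊇ (forest-resp-↭ N₂N₁R↭ forest) λ {M} N₂N₁R↭′ → begin
        avg (points N₂) (points M)   ≤⟨ maximal (↭-trans G↭ (↭-trans N₂N₁R↭ N₂N₁R↭′)) ⟩
        -- Maximality is stated for the link in the order `N₁`, `N₂`; symmetry of `S` carries it
        -- over to the reverse order.
        avg (points N₁) (points N₂)  ≈⟨ avg-sym S-sym (points N₁) (points N₂) ⟩
        avg (points N₂) (points N₁)  ∎

      -- The only dangerous cases join a node inside `C` to a node missing `C`. There the inner node
      -- is all of `C`, so the union contains `C`.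
      compatible : ∀ {C} → C List.∈ clusters target → Compatible (points N₁) C → Compatible (points N₂) C →
                   Compatible (points N₁ ∪ points N₂) C
      compatible C∈ (inj₂ (inj₁ C⊆N₁)) _ = inj₂ (inj₁ (p⊆p∪q (points N₂) ∘ C⊆N₁))
      compatible C∈ (inj₁ _) (inj₂ (inj₁ C⊆N₂)) = inj₂ (inj₁ (q⊆p∪q (points N₁) (points N₂) ∘ C⊆N₂))
      compatible C∈ (inj₂ (inj₂ _)) (inj₂ (inj₁ C⊆N₂)) = inj₂ (inj₁ (q⊆p∪q (points N₁) (points N₂) ∘ C⊆N₂))
      compatible C∈ (inj₁ N₁⊆C) (inj₁ N₂⊆C) = inj₁ λ x∈ → [ N₁⊆C , N₂⊆C ]′ (x∈p∪q⁻ (points N₁) (points N₂) x∈)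
      compatible C∈ (inj₁ N₁⊆C) (inj₂ (inj₂ N₂∥C)) = inj₂ (inj₁ (p⊆p∪q (points N₂) ∘ C⊆N₁ C∈ N₁⊆C N₂∥C))
      compatible C∈ (inj₂ (inj₂ N₁∥C)) (inj₁ N₂⊆C) =
        inj₂ (inj₁ (q⊆p∪q (points N₁) (points N₂) ∘ C⊆N₂ C∈ N₂⊆C N₁∥C))
      compatible {C} C∈ (inj₂ (inj₂ N₁∥C)) (inj₂ (inj₂ N₂∥C)) = inj₂ (inj₂ λ (x , x∈) →
        let x∈N , x∈C = x∈p∩q⁻ (points N₁ ∪ points N₂) C x∈ in ∪-disjoint {C} N₁∥C N₂∥C x∈N x∈C)

    leaves-forest : LaminarForest (map leaf (allFin n))
    leaves-forest = record
      { separated = AllPairs.map⁺ (AllPairs.map⁺ (AllPairs.map ⁅⁆-disjoint (allFin⁺ n)))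
      ; covering  = λ x → Any.map⁺ (Any.map⁺ (Any.map (λ {≡.refl → x∈⁅x⁆ x}) (∈-allFin x)))
      ; laminar   = All.map⁺ (All.universal leaf (allFin n))
      }
      where
      ⁅⁆-disjoint : ∀ {x y} → x ≢ y → Disjoint ⁅ x ⁆ ⁅ y ⁆
      ⁅⁆-disjoint {x} {y} x≢y (z , z∈) = let z∈x , z∈y = x∈p∩q⁻ ⁅ x ⁆ ⁅ y ⁆ z∈ in
        x≢y (≡.trans (≡.sym (x∈⁅y⁆⇒x≡y x z∈x)) (x∈⁅y⁆⇒x≡y y z∈y))

    ⇒*-preserves-forest : ∀ {G G′} → LaminarForest G → Star (_⇒_ F S) G G′ → LaminarForest G′
    ⇒*-preserves-forest forest ε            = forest
    ⇒*-preserves-forest forest (step ◅ steps) = ⇒*-preserves-forest (⇒-preserves-forest forest step) steps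

    averageLinkageTree-laminar : ∀ {T} → IsAverageLinkageTree F S T →
      Laminar (clusters target) T × (∀ x → x ∈ points T)
    averageLinkageTree-laminar steps with ⇒*-preserves-forest leaves-forest steps
    ... | forest = All.head (laminar forest) , λ x → Any.singleton⁻ (covering forest x)

-- Counting misclassified pairs

module PairCounting where
  open import Data.Nat.ListAction using (sum)
  open import Data.Nat.ListAction.Properties using (sum-++)
  open import Data.Nat.Base using (_+_; _*_; _≤_; _<_; z≤n; s≤s)
  open ≡ using (refl; sym; trans; cong; cong₂; subst)

  sum-map-mono : {f g : I → ℕ} → (∀ x → f x ≤ g x) → ∀ xs → sum (map f xs) ≤ sum (map g xs)
  sum-map-mono f≤g []       = z≤n
  sum-map-mono f≤g (x ∷ xs) = ℕₚ.+-mono-≤ (f≤g x) (sum-map-mono f≤g xs)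

  sum-map-+ : (f g : I → ℕ) → ∀ xs → sum (map (λ x → f x + g x) xs) ≡ sum (map f xs) + sum (map g xs)
  sum-map-+ f g []       = refl
  sum-map-+ f g (x ∷ xs) = trans (cong (f x + g x +_) (sum-map-+ f g xs)) (rearrange (f x) (g x) _ _)
    where
    rearrange : ∀ a b c d → a + b + (c + d) ≡ a + c + (b + d)
    rearrange = solve-∀

  sum-map-* : ∀ k (g : I → ℕ) xs → sum (map (λ x → k * g x) xs) ≡ k * sum (map g xs)
  sum-map-* k g []       = sym (ℕₚ.*-zeroʳ k)
  sum-map-* k g (x ∷ xs) = trans (cong (k * g x +_) (sum-map-* k g xs)) (sym (ℕₚ.*-distribˡ-+ k (g x) _))

  sum-cartesianProduct-* : (f g : I → ℕ) → ∀ xs ys →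
    sum (map (λ (x , y) → f x * g y) (cartesianProduct xs ys)) ≡ sum (map f xs) * sum (map g ys)
  sum-cartesianProduct-* f g []       ys = refl
  sum-cartesianProduct-* f g (x ∷ xs) ys = begin
    sum (map h (map (x ,_) ys ++ cartesianProduct xs ys))
      ≡⟨ cong sum (map-++ h (map (x ,_) ys) _) ⟩
    sum (map h (map (x ,_) ys) ++ map h (cartesianProduct xs ys))
      ≡⟨ sum-++ (map h (map (x ,_) ys)) _ ⟩
    sum (map h (map (x ,_) ys)) + sum (map h (cartesianProduct xs ys))
      ≡⟨ cong₂ _+_ (cong sum (sym (map-∘ ys))) (sum-cartesianProduct-* f g xs ys) ⟩
    sum (map (λ y → f x * g y) ys) + sum (map f xs) * sum (map g ys)
      ≡⟨ cong (_+ _) (sum-map-* (f x) g ys) ⟩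
    f x * sum (map g ys) + sum (map f xs) * sum (map g ys)
      ≡⟨ ℕₚ.*-distribʳ-+ (sum (map g ys)) (f x) _ ⟨
    (f x + sum (map f xs)) * sum (map g ys)  ∎
    where
    open ≡.≡-Reasoning
    h = λ (x , y) → f x * g y

  length-filter : ∀ {p} {P : I → Set p} (P? : ∀ x → Dec (P x)) xs →
    length (filter P? xs) ≡ sum (map (λ x → if does (P? x) then 1 else 0) xs)
  length-filter P? []       = refl
  length-filter P? (x ∷ xs) with does (P? x)
  ... | true  = cong ℕ.suc (length-filter P? xs)
  ... | false = length-filter P? xs

  𝟙 : Bool → ℕ
  𝟙 b = if b then 1 else 0

  indicator : Subset n → Fin n → ℕ
  indicator A x = 𝟙 (does (x ∈? A))

  sum-indicator : (A : Subset n) → sum (map (indicator A) (allFin n)) ≡ ∣ A ∣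
  sum-indicator A = trans (cong sum (map-tabulate id (indicator A))) (go A)
    where
    go : ∀ {n} (A : Subset n) → sum (tabulate (indicator A)) ≡ ∣ A ∣
    go []            = refl
    go (inside ∷ A)  = cong ℕ.suc (go A)
    go (outside ∷ A) = go A

  does-∈-∩ : (A B : Subset n) → ∀ x → does (x ∈? A ∩ B) ≡ does (x ∈? A) ∧ does (x ∈? B)
  does-∈-∩ A B x = does-⇔ (mk⇔ (x∈p∩q⁻ A B) x∈p∩q⁺) (x ∈? A ∩ B) (x ∈? A ×-dec x ∈? B)

  does-∈-─ : (A B : Subset n) → ∀ x → does (x ∈? A ─ B) ≡ does (x ∈? A) ∧ not (does (x ∈? B))
  does-∈-─ A B x = does-⇔ (mk⇔ (x∈p─q⁻ A B) (λ (x∈A , x∉B) → x∈p∧x∉q⇒x∈p─q x∈A x∉B))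
    (x ∈? A ─ B) (x ∈? A ×-dec ¬? (x ∈? B))

  ∣p∣≡∣p∩q∣+∣p─q∣ : (A B : Subset n) → ∣ A ∣ ≡ ∣ A ∩ B ∣ + ∣ A ─ B ∣
  ∣p∣≡∣p∩q∣+∣p─q∣ []            []            = refl
  ∣p∣≡∣p∩q∣+∣p─q∣ (inside  ∷ A) (inside  ∷ B) = cong ℕ.suc (∣p∣≡∣p∩q∣+∣p─q∣ A B)
  ∣p∣≡∣p∩q∣+∣p─q∣ (inside  ∷ A) (outside ∷ B) = trans (cong ℕ.suc (∣p∣≡∣p∩q∣+∣p─q∣ A B)) (sym (ℕₚ.+-suc _ _))
  ∣p∣≡∣p∩q∣+∣p─q∣ (outside ∷ A) (inside  ∷ B) = ∣p∣≡∣p∩q∣+∣p─q∣ A B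
  ∣p∣≡∣p∩q∣+∣p─q∣ (outside ∷ A) (outside ∷ B) = ∣p∣≡∣p∩q∣+∣p─q∣ A B

  Together : List (Subset n) → Fin n → Fin n → Set
  Together L u v = Any (λ A → u ∈ A × v ∈ A) L

  together? : (L : List (Subset n)) (u v : Fin n) → Dec (Together L u v)
  together? L u v = any? (λ A → (u ∈? A) ×-dec (v ∈? A)) L

  Together-sym : {L : List (Subset n)} {u v : Fin n} → Together L u v → Together L v u
  Together-sym = Any.map Product.swap

  disjoint-unique : {L : List (Subset n)} → AllPairs Disjoint L → ∀ {A B x} →
    A List.∈ L → B List.∈ L → x ∈ A → x ∈ B → A ≡ B
  disjoint-unique L∥ {A} {B} {x} A∈ B∈ x∈A x∈B with ∈-AllPairs₂ L∥ A∈ B∈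
  ... | inj₁ A≡B        = A≡B
  ... | inj₂ (inj₁ A∥B) = contradiction (x , x∈p∩q⁺ (x∈A , x∈B)) A∥B
  ... | inj₂ (inj₂ B∥A) = contradiction (x , x∈p∩q⁺ (x∈B , x∈A)) B∥A

  -- Disjointness makes `A` the only cluster through `u`, so one membership test decides whom `u` is
  -- together with.
  Together⇔∈ : {L : List (Subset n)} → AllPairs Disjoint L → ∀ {A u v} → A List.∈ L → u ∈ A →
    Together L u v ⇔ v ∈ A
  Together⇔∈ {L = L} L∥ {A} {u} {v} A∈ u∈A = mk⇔ to (λ v∈A → List.lose A∈ (u∈A , v∈A))
    where
    to : Together L u v → v ∈ A
    to t with B , B∈ , u∈B , v∈B ← List.find t = subst (v ∈_) (disjoint-unique L∥ B∈ A∈ u∈B u∈A) v∈B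

  mismatch : Bool → Bool → ℕ
  mismatch a b = 𝟙 (does (¬? (a Bool.≟ b)))

  ∑∑ : (Fin n × Fin n → ℕ) → ℕ
  ∑∑ {n} f = sum (map f (cartesianProduct (allFin n) (allFin n)))

  δcc≡∑∑ : (D C : Clustering n) →
    δcc D C ≡ ∑∑ λ (u , v) → mismatch (sameCluster (clusters D) u v) (sameCluster (clusters C) u v)
  δcc≡∑∑ {n} D C = length-filter
    (λ (u , v) → ¬? (sameCluster (clusters D) u v Bool.≟ sameCluster (clusters C) u v))
    (cartesianProduct (allFin n) (allFin n))

  -- Reduces a comparison of errors to single pairs. The credit `f` and the debit `g` stay on
  -- opposite sides to avoid subtraction of natural numbers.
  δcc-+-mono : (D E C : Clustering n) {f g : Fin n × Fin n → ℕ} →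
    (∀ u v → mismatch (sameCluster (clusters E) u v) (sameCluster (clusters C) u v) + f (u , v)
           ≤ mismatch (sameCluster (clusters D) u v) (sameCluster (clusters C) u v) + g (u , v)) →
    δcc E C + ∑∑ f ≤ δcc D C + ∑∑ g
  δcc-+-mono {n} D E C {f} {g} E+f≤D+g = begin
    δcc E C + ∑∑ f                              ≡⟨ cong (_+ ∑∑ f) (δcc≡∑∑ E C) ⟩
    ∑∑ (m E) + ∑∑ f                             ≡⟨ sum-map-+ (m E) f pairs ⟨
    sum (map (λ p → m E p + f p) pairs)         ≤⟨ sum-map-mono (λ (u , v) → E+f≤D+g u v) pairs ⟩
    sum (map (λ p → m D p + g p) pairs)         ≡⟨ sum-map-+ (m D) g pairs ⟩
    ∑∑ (m D) + ∑∑ g                             ≡⟨ cong (_+ ∑∑ g) (δcc≡∑∑ D C) ⟨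
    δcc D C + ∑∑ g                              ∎
    where
    open ℕₚ.≤-Reasoning
    pairs = cartesianProduct (allFin n) (allFin n)
    m : Clustering n → Fin n × Fin n → ℕ
    m D (u , v) = mismatch (sameCluster (clusters D) u v) (sameCluster (clusters C) u v)

  ∑∑-indicators : (A B : Subset n) → ∑∑ (λ (u , v) → indicator A u * indicator B v) ≡ ∣ A ∣ * ∣ B ∣
  ∑∑-indicators {n} A B = trans (sum-cartesianProduct-* (indicator A) (indicator B) (allFin n) (allFin n))
    (cong₂ _*_ (sum-indicator A) (sum-indicator B))

  -- Passing from `D` to `E` undoes only pairs that are apart in the target, which turns mistakes
  -- into matches.
  mismatch-mono : {D E T : Set} (d : Dec D) (e : Dec E) (t : Dec T) → (E → D) → (D → E ⊎ ¬ T) →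
    mismatch (does e) (does t) ≤ mismatch (does d) (does t)
  mismatch-mono (yes _) (yes _) _       _   _ = ℕₚ.≤-refl
  mismatch-mono (no _)  (no _)  _       _   _ = ℕₚ.≤-refl
  mismatch-mono (no ¬d) (yes e) _       e⇒d _ = contradiction (e⇒d e) ¬d
  mismatch-mono (yes _) (no _)  (no _)  _   _ = z≤n
  mismatch-mono (yes d) (no ¬e) (yes t) _   d⇒e⊎¬t =
    [ (λ e → contradiction e ¬e) , contradiction t ]′ (d⇒e⊎¬t d)

  -- A split can only undo pairs of different target clusters, and it undoes all
  -- of those between its two parts x and y.
  split-mismatch-≤ : {D E T X Y : Set} (d : Dec D) (e : Dec E) (t : Dec T) (x : Dec X) (y : Dec Y) →
    (E → D) → (D → E ⊎ ¬ T) → (X → Y → D × ¬ E) →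
    mismatch (does e) (does t) + 𝟙 (does x) * 𝟙 (does y) ≤ mismatch (does d) (does t) + 0
  split-mismatch-≤ d e t (yes x) (yes y) _ d⇒e⊎¬t xy⇒d¬e with xy⇒d¬e x y
  ... | d′ , ¬e′ with d⇒e⊎¬t d′
  ...   | inj₁ e′  = contradiction e′ ¬e′
  ...   | inj₂ ¬t′ rewrite dec-true d d′ | dec-false e ¬e′ | dec-false t ¬t′ = ℕₚ.≤-refl
  split-mismatch-≤ d e t (yes _) (no _) e⇒d d⇒e⊎¬t _ = ℕₚ.+-monoˡ-≤ 0 (mismatch-mono d e t e⇒d d⇒e⊎¬t)
  split-mismatch-≤ d e t (no _)  _      e⇒d d⇒e⊎¬t _ = ℕₚ.+-monoˡ-≤ 0 (mismatch-mono d e t e⇒d d⇒e⊎¬t)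

  -- Stated for a point v outside of P and a point of P: d, e and t say whether
  -- they are together before the merge, after it, and in the target.
  merge-mismatch-≤ : {D E T A B C : Set} (d : Dec D) (e : Dec E) (t : Dec T)
    (a : Dec A) (b : Dec B) (c : Dec C) → D ⇔ B → E ⇔ A → T ⇔ C → ¬ (A × B) →
    mismatch (does e) (does t) + 𝟙 (does a ∧ does c) ≤
    mismatch (does d) (does t) + (𝟙 (does a ∧ not (does c)) + 𝟙 (does b))
  merge-mismatch-≤ d e t a b c D⇔B E⇔A T⇔C ¬ab
    rewrite does-⇔ D⇔B d b | does-⇔ E⇔A e a | does-⇔ T⇔C t c with a | b | c
  ... | yes a′ | yes b′ | _     = contradiction (a′ , b′) ¬ab
  ... | yes _  | no _   | yes _ = ℕₚ.≤-refl
  ... | yes _  | no _   | no _  = ℕₚ.≤-refl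
  ... | no _   | yes _  | yes _ = ℕₚ.≤-refl
  ... | no _   | yes _  | no _  = z≤n
  ... | no _   | no _   | yes _ = ℕₚ.≤-refl
  ... | no _   | no _   | no _  = z≤n

  -- The error after a split

  module _ (D E target : Clustering n) {A X Y : Subset n} {R : List (Subset n)}
    (D↭ : clusters D ↭ A ∷ R) (E↭ : clusters E ↭ X ∷ Y ∷ R)
    (X⊆A : X ⊆ A) (Y⊆A : Y ⊆ A) (A⊆X∪Y : ∀ {x} → x ∈ A → x ∈ X ⊎ x ∈ Y)
    (separated : ∀ {u v} → u ∈ X → v ∈ Y → ¬ Together (clusters target) u v) where

    private
      E∥ : AllPairs Disjoint (X ∷ Y ∷ R)
      E∥ = AllPairs-disjoint-resp-↭ E↭ (disjoint E)

      unsplit : ∀ {u v} → Together (X ∷ Y ∷ R) u v → Together (A ∷ R) u v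
      unsplit (here (u∈X , v∈X))         = here (X⊆A u∈X , X⊆A v∈X)
      unsplit (there (here (u∈Y , v∈Y))) = here (Y⊆A u∈Y , Y⊆A v∈Y)
      unsplit (there (there t))          = there t

      unsplit⁻ : ∀ {u v} → Together (A ∷ R) u v →
                 Together (X ∷ Y ∷ R) u v ⊎ ¬ Together (clusters target) u v
      unsplit⁻ (there t) = inj₁ (there (there t))
      unsplit⁻ (here (u∈A , v∈A)) with A⊆X∪Y u∈A | A⊆X∪Y v∈A
      ... | inj₁ u∈X | inj₁ v∈X = inj₁ (here (u∈X , v∈X))
      ... | inj₂ u∈Y | inj₂ v∈Y = inj₁ (there (here (u∈Y , v∈Y)))
      ... | inj₁ u∈X | inj₂ v∈Y = inj₂ (separated u∈X v∈Y)
      ... | inj₂ u∈Y | inj₁ v∈X = inj₂ (separated v∈X u∈Y ∘ Together-sym)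

      apart : ∀ {u v} → u ∈ X → v ∈ Y → ¬ Together (X ∷ Y ∷ R) u v
      apart {v = v} u∈X v∈Y t = All.head (AllPairs.head E∥)
        (v , x∈p∩q⁺ (Equivalence.to (Together⇔∈ E∥ (here refl) u∈X) t , v∈Y))

    -- Only the ordered pairs from `X` to `Y` are credited; both parts being nonempty, there is at
    -- least one, and this is enough for strictness.
    split-decreases : Nonempty X → Nonempty Y → δcc E target < δcc D target
    split-decreases X≠∅ Y≠∅ = begin-strict
      δcc E target
        <⟨ ℕₚ.m<m+n _ (ℕₚ.*-mono-< (nonempty⇒0<∣p∣ X≠∅) (nonempty⇒0<∣p∣ Y≠∅)) ⟩
      δcc E target + ∣ X ∣ * ∣ Y ∣
        ≡⟨ cong (δcc E target +_) (∑∑-indicators X Y) ⟨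
      δcc E target + ∑∑ (λ (u , v) → indicator X u * indicator Y v)
        ≤⟨ δcc-+-mono D E target (λ u v → split-mismatch-≤
             (together? (clusters D) u v) (together? (clusters E) u v)
             (together? (clusters target) u v) (u ∈? X) (v ∈? Y)
             (Any-resp-↭ (↭-sym D↭) ∘ unsplit ∘ Any-resp-↭ E↭)
             ([ inj₁ ∘ Any-resp-↭ (↭-sym E↭) , inj₂ ]′ ∘ unsplit⁻ ∘ Any-resp-↭ D↭)
             λ u∈X v∈Y → Any-resp-↭ (↭-sym D↭) (here (X⊆A u∈X , Y⊆A v∈Y))
                       , apart u∈X v∈Y ∘ Any-resp-↭ E↭) ⟩
      δcc D target + ∑∑ {n} (λ _ → 0)
        ≡⟨ cong (δcc D target +_) (sum-map-* 0 (λ _ → 0) (cartesianProduct (allFin n) (allFin n))) ⟩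
      δcc D target + 0
        ≡⟨ ℕₚ.+-identityʳ _ ⟩
      δcc D target  ∎
      where open ℕₚ.≤-Reasoning

  -- The error after a merge

  moved-disjoint : (A B N : Subset n) {R : List (Subset n)} → AllPairs Disjoint (A ∷ B ∷ R) →
    AllPairs Disjoint (A ∪ (N ∩ B) ∷ (B ─ N) ∷ R)
  moved-disjoint A B N {R} ((A∥B ∷ A∥R) ∷ B∥R ∷ R∥) =
    (from-∪ {B ─ N} (λ x∈A x∈B─N → A∥B (_ , x∈p∩q⁺ (x∈A , p─q⊆p B N x∈B─N)))
                    (λ x∈N∩B x∈B─N → proj₂ (x∈p─q⁻ B N x∈B─N) (p∩q⊆p N B x∈N∩B)) ∷
     All.zipWith (λ {M} (A∥M , B∥M) → from-∪ {M} (λ x∈A x∈M → A∥M (_ , x∈p∩q⁺ (x∈A , x∈M)))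
                                                 (λ x∈N∩B x∈M → B∥M (_ , x∈p∩q⁺ (p∩q⊆q N B x∈N∩B , x∈M))))
      (A∥R , B∥R)) ∷
    All.map (λ {M} B∥M (x , x∈) → let x∈B─N , x∈M = x∈p∩q⁻ (B ─ N) M x∈ in
      B∥M (x , x∈p∩q⁺ (p─q⊆p B N x∈B─N , x∈M))) B∥R ∷
    R∥
    where
    from-∪ : ∀ {M} → (∀ {x} → x ∈ A → ¬ x ∈ M) → (∀ {x} → x ∈ N ∩ B → ¬ x ∈ M) → Disjoint (A ∪ (N ∩ B)) M
    from-∪ {M} ¬A ¬N∩B (x , x∈) with x∈p∩q⁻ (A ∪ (N ∩ B)) M x∈
    ... | x∈∪ , x∈M with x∈p∪q⁻ A (N ∩ B) x∈∪
    ...   | inj₁ x∈A   = ¬A x∈A x∈M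
    ...   | inj₂ x∈N∩B = ¬N∩B x∈N∩B x∈M

  -- Here `g` and `x` stand for the sizes of `A ∩ C` and `A ─ C`, and `p` and `y` for those of `P`
  -- and `B ─ N`. The hypotheses amount to `2x < g` and `2y < p`, so `3y < p + y ≤ g + x` and
  -- `3(x + y) ≤ 4x + g < 3g`. Exactly at two thirds, `g = 2x`, `p = 2y` and `x = y` would give
  -- `x + y = g`, and the estimate would yield no decrease.
  two-thirds-arith : ∀ p g x y → 2 * (g + x) < g * 3 → 2 * (p + y) < p * 3 → p + y ≤ g + x → x + y < g
  two-thirds-arith p g x y 2gx<3g 2py<3p py≤gx = ℕₚ.*-cancelˡ-< 3 (x + y) g (begin-strict
    3 * (x + y)        ≡⟨ e₁ x y ⟩
    3 * x + (2 * y + y) ≤⟨ ℕₚ.+-monoʳ-≤ (3 * x) (ℕₚ.+-monoˡ-≤ y (ℕₚ.<⇒≤ 2y<p)) ⟩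
    3 * x + (p + y)    ≤⟨ ℕₚ.+-monoʳ-≤ (3 * x) py≤gx ⟩
    3 * x + (g + x)    ≡⟨ e₂ x g ⟩
    2 * (2 * x) + g    <⟨ ℕₚ.+-monoˡ-< g (ℕₚ.*-monoʳ-< 2 2x<g) ⟩
    2 * g + g          ≡⟨ e₃ g ⟩
    3 * g              ∎)
    where
    open ℕₚ.≤-Reasoning
    e₁ : ∀ x y → 3 * (x + y) ≡ 3 * x + (2 * y + y)
    e₁ = solve-∀
    e₂ : ∀ x g → 3 * x + (g + x) ≡ 2 * (2 * x) + g
    e₂ = solve-∀
    e₃ : ∀ g → 2 * g + g ≡ 3 * g
    e₃ = solve-∀
    minority : ∀ g x → 2 * (g + x) < g * 3 → 2 * x < g
    minority g x lt = ℕₚ.+-cancelˡ-< (2 * g) (2 * x) g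
      (ℕₚ.≤-trans (ℕₚ.≤-reflexive (cong ℕ.suc (sym (ℕₚ.*-distribˡ-+ 2 g x))))
        (ℕₚ.≤-trans lt (ℕₚ.≤-reflexive (e₄ g))))
      where
      e₄ : ∀ g → g * 3 ≡ 2 * g + g
      e₄ = solve-∀
    2x<g = minority g x 2gx<3g
    2y<p = minority p y 2py<3p

  module _ (D E target : Clustering n) {A B N C : Subset n} {R : List (Subset n)}
    (D↭ : clusters D ↭ A ∷ B ∷ R)
    -- Only the relation `Together` of `E` enters, so neither discarded empty clusters nor the order
    -- of the list matters.
    (E⇔ : ∀ {u v} → Together (clusters E) u v ⇔ Together (A ∪ (N ∩ B) ∷ (B ─ N) ∷ R) u v)
    (C∈ : C List.∈ clusters target) (N∩B⊆C : N ∩ B ⊆ C) where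

    private
      P = N ∩ B

      D∥ : AllPairs Disjoint (A ∷ B ∷ R)
      D∥ = AllPairs-disjoint-resp-↭ D↭ (disjoint D)

      A∥B : Disjoint A B
      A∥B = All.head (AllPairs.head D∥)

      E∥ = moved-disjoint A B N D∥

      D⇔ : ∀ {u v} → Together (clusters D) u v ⇔ Together (A ∷ B ∷ R) u v
      D⇔ = mk⇔ (Any-resp-↭ D↭) (Any-resp-↭ (↭-sym D↭))

      remains : ∀ {v} → v ∉ P → v ∈ B → v ∈ B ─ N
      remains v∉P v∈B = x∈p∧x∉q⇒x∈p─q v∈B λ v∈N → v∉P (x∈p∩q⁺ (v∈N , v∈B))

      not-moved : ∀ {v} → v ∉ P → v ∈ A ∪ P → v ∈ A
      not-moved v∉P v∈A∪P with x∈p∪q⁻ A P v∈A∪P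
      ... | inj₁ v∈A = v∈A
      ... | inj₂ v∈P = contradiction v∈P v∉P

      unmoved : ∀ {u v} → u ∉ P → v ∉ P → Together (clusters D) u v ⇔ Together (clusters E) u v
      unmoved u∉P v∉P = mk⇔ (Equivalence.from E⇔ ∘ to ∘ Equivalence.to D⇔)
                            (Equivalence.from D⇔ ∘ from ∘ Equivalence.to E⇔)
        where
        to : Together (A ∷ B ∷ R) _ _ → Together (A ∪ P ∷ (B ─ N) ∷ R) _ _
        to (here (u∈A , v∈A))         = here (p⊆p∪q P u∈A , p⊆p∪q P v∈A)
        to (there (here (u∈B , v∈B))) = there (here (remains u∉P u∈B , remains v∉P v∈B))
        to (there (there t))          = there (there t)
        from : Together (A ∪ P ∷ (B ─ N) ∷ R) _ _ → Together (A ∷ B ∷ R) _ _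
        from (here (u∈ , v∈))         = here (not-moved u∉P u∈ , not-moved v∉P v∈)
        from (there (here (u∈ , v∈))) = there (here (p─q⊆p B N u∈ , p─q⊆p B N v∈))
        from (there (there t))        = there (there t)

      m : Clustering n → Fin n → Fin n → ℕ
      m D u v = mismatch (sameCluster (clusters D) u v) (sameCluster (clusters target) u v)

      m-sym : ∀ D u v → m D u v ≡ m D v u
      m-sym D u v = cong₂ mismatch (same-sym (clusters D)) (same-sym (clusters target))
        where
        same-sym : ∀ L → sameCluster L u v ≡ sameCluster L v u
        same-sym L = does-⇔ (mk⇔ Together-sym Together-sym) (together? L u v) (together? L v u)

      m-cong : ∀ {u v} → Together (clusters D) u v ⇔ Together (clusters E) u v → m E u v ≡ m D u v
      m-cong {u} {v} D⇔E = cong (λ b → mismatch b (sameCluster (clusters target) u v))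
        (sym (does-⇔ D⇔E (together? (clusters D) u v) (together? (clusters E) u v)))

      -- `loss` charges every point of `B ─ N`, even those outside `C`, whose separation from a
      -- moved point is in fact an improvement.
      gain loss : Fin n → ℕ
      gain = indicator (A ∩ C)
      loss v = indicator (A ─ C) v + indicator (B ─ N) v

      moved-row : ∀ {u v} → u ∈ P → v ∉ P → m E u v + gain v ≤ m D u v + loss v
      moved-row {u} {v} u∈P v∉P rewrite does-∈-∩ A C v | does-∈-─ A C v =
        merge-mismatch-≤ (together? (clusters D) u v) (together? (clusters E) u v)
          (together? (clusters target) u v) (v ∈? A) (v ∈? B ─ N) (v ∈? C)
          (mk⇔ (remains v∉P ∘ Equivalence.to in-B ∘ Equivalence.to D⇔)
               (Equivalence.from D⇔ ∘ Equivalence.from in-B ∘ p─q⊆p B N))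
          (mk⇔ (not-moved v∉P ∘ Equivalence.to in-A∪P ∘ Equivalence.to E⇔)
               (Equivalence.from E⇔ ∘ Equivalence.from in-A∪P ∘ p⊆p∪q P))
          (Together⇔∈ (disjoint target) C∈ (N∩B⊆C u∈P))
          λ (v∈A , v∈B─N) → A∥B (v , x∈p∩q⁺ (v∈A , p─q⊆p B N v∈B─N))
        where
        in-B : Together (A ∷ B ∷ R) u v ⇔ v ∈ B
        in-B = Together⇔∈ D∥ (there (here refl)) (p∩q⊆q N B u∈P)
        in-A∪P : Together (A ∪ P ∷ (B ─ N) ∷ R) u v ⇔ v ∈ A ∪ P
        in-A∪P = Together⇔∈ E∥ (here refl) (q⊆p∪q A P u∈P)

      gain≡0 : ∀ {v} → v ∈ P → gain v ≡ 0
      gain≡0 {v} v∈P = cong 𝟙 (dec-false (v ∈? A ∩ C) λ v∈A∩C →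
        A∥B (v , x∈p∩q⁺ (p∩q⊆p A C v∈A∩C , p∩q⊆q N B v∈P)))

      -- A pair can change only if exactly one of its points is moved, and `δcc` counts ordered
      -- pairs; hence the two symmetric terms. Moved points lie outside `A`, so a pair of moved
      -- points is credited nothing.
      gains losses : Fin n × Fin n → ℕ
      gains (u , v)  = indicator P u * gain v + gain u * indicator P v
      losses (u , v) = indicator P u * loss v + loss u * indicator P v

      merge-mismatch : ∀ u v → m E u v + gains (u , v) ≤ m D u v + losses (u , v)
      merge-mismatch u v with u ∈? P | v ∈? P
      ... | yes u∈P | yes v∈P rewrite gain≡0 u∈P | gain≡0 v∈P = begin
        m E u v + 0          ≡⟨ ℕₚ.+-identityʳ _ ⟩
        m E u v              ≡⟨ m-cong (mk⇔
                                  (λ _ → Equivalence.from E⇔ (here (q⊆p∪q A P u∈P , q⊆p∪q A P v∈P)))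
                                  (λ _ → Equivalence.from D⇔ (there (here (p∩q⊆q N B u∈P , p∩q⊆q N B v∈P))))) ⟩
        m D u v              ≤⟨ ℕₚ.m≤m+n _ _ ⟩
        m D u v + _          ∎
        where open ℕₚ.≤-Reasoning
      ... | yes u∈P | no v∉P = begin
        m E u v + (1 * gain v + gain u * 0)  ≡⟨ cong (m E u v +_) (row (gain v) (gain u)) ⟩
        m E u v + gain v                     ≤⟨ moved-row u∈P v∉P ⟩
        m D u v + loss v                     ≡⟨ cong (m D u v +_) (row (loss v) (loss u)) ⟨
        m D u v + (1 * loss v + loss u * 0)  ∎
        where
        open ℕₚ.≤-Reasoning
        row : ∀ x y → 1 * x + y * 0 ≡ x
        row = solve-∀
      ... | no u∉P | yes v∈P = begin
        m E u v + gain u * 1  ≡⟨ cong₂ _+_ (m-sym E u v) (ℕₚ.*-identityʳ (gain u)) ⟩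
        m E v u + gain u      ≤⟨ moved-row v∈P u∉P ⟩
        m D v u + loss u      ≡⟨ cong₂ _+_ (m-sym D u v) (ℕₚ.*-identityʳ (loss u)) ⟨
        m D u v + loss u * 1  ∎
        where open ℕₚ.≤-Reasoning
      ... | no u∉P | no v∉P = begin
        m E u v + gain u * 0  ≡⟨ cong₂ _+_ (m-cong (unmoved u∉P v∉P)) (ℕₚ.*-zeroʳ (gain u)) ⟩
        m D u v + 0           ≡⟨ cong (m D u v +_) (ℕₚ.*-zeroʳ (loss u)) ⟨
        m D u v + loss u * 0  ∎
        where open ℕₚ.≤-Reasoning

      pairs = cartesianProduct (allFin n) (allFin n)

      ∑∑-symmetric : (f : Fin n → ℕ) →
        ∑∑ (λ (u , v) → indicator P u * f v + f u * indicator P v) ≡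
        2 * (∣ P ∣ * sum (map f (allFin n)))
      ∑∑-symmetric f = begin
        ∑∑ (λ (u , v) → indicator P u * f v + f u * indicator P v)
          ≡⟨ sum-map-+ (λ (u , v) → indicator P u * f v) (λ (u , v) → f u * indicator P v) pairs ⟩
        ∑∑ (λ (u , v) → indicator P u * f v) + ∑∑ (λ (u , v) → f u * indicator P v)
          ≡⟨ cong₂ _+_ (sum-cartesianProduct-* (indicator P) f (allFin n) (allFin n))
                       (sum-cartesianProduct-* f (indicator P) (allFin n) (allFin n)) ⟩
        sum (map (indicator P) (allFin n)) * s + s * sum (map (indicator P) (allFin n))
          ≡⟨ cong (λ p → p * s + s * p) (sum-indicator P) ⟩
        ∣ P ∣ * s + s * ∣ P ∣
          ≡⟨ double ∣ P ∣ s ⟩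
        2 * (∣ P ∣ * s)  ∎
        where
        open ≡.≡-Reasoning
        s = sum (map f (allFin n))
        double : ∀ p s → p * s + s * p ≡ 2 * (p * s)
        double = solve-∀

      merge-balance : δcc E target + 2 * (∣ P ∣ * ∣ A ∩ C ∣) ≤
                      δcc D target + 2 * (∣ P ∣ * (∣ A ─ C ∣ + ∣ B ─ N ∣))
      merge-balance = begin
        δcc E target + 2 * (∣ P ∣ * ∣ A ∩ C ∣)
          ≡⟨ cong (λ s → δcc E target + 2 * (∣ P ∣ * s)) (sum-indicator (A ∩ C)) ⟨
        δcc E target + 2 * (∣ P ∣ * sum (map gain (allFin n)))
          ≡⟨ cong (δcc E target +_) (∑∑-symmetric gain) ⟨
        δcc E target + ∑∑ gains
          ≤⟨ δcc-+-mono D E target merge-mismatch ⟩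
        δcc D target + ∑∑ losses
          ≡⟨ cong (δcc D target +_) (∑∑-symmetric loss) ⟩
        δcc D target + 2 * (∣ P ∣ * sum (map loss (allFin n)))
          ≡⟨ cong (λ s → δcc D target + 2 * (∣ P ∣ * s)) (trans
             (sum-map-+ (indicator (A ─ C)) (indicator (B ─ N)) (allFin n))
               (cong₂ _+_ (sum-indicator (A ─ C)) (sum-indicator (B ─ N)))) ⟩
        δcc D target + 2 * (∣ P ∣ * (∣ A ─ C ∣ + ∣ B ─ N ∣))  ∎
        where open ℕₚ.≤-Reasoning

    merge-decreases : ∣ B ∣ ≤ ∣ A ∣ → 2 * ∣ A ∣ < ∣ C ∩ A ∣ * 3 → 2 * ∣ B ∣ < ∣ N ∩ B ∣ * 3 →
      δcc E target < δcc D target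
    merge-decreases B≤A 2A<3C∩A 2B<3P =
      ℕₚ.+-cancelʳ-< (2 * (∣ P ∣ * l)) (δcc E target) (δcc D target) (begin-strict
      δcc E target + 2 * (∣ P ∣ * l)
        <⟨ ℕₚ.+-monoʳ-< (δcc E target) (ℕₚ.*-monoʳ-< 2 (ℕₚ.*-monoʳ-< ∣ P ∣ l<A∩C)) ⟩
      δcc E target + 2 * (∣ P ∣ * ∣ A ∩ C ∣)
        ≤⟨ merge-balance ⟩
      δcc D target + 2 * (∣ P ∣ * l)          ∎)
      where
      open ℕₚ.≤-Reasoning
      l = ∣ A ─ C ∣ + ∣ B ─ N ∣
      instance
        -- If nothing were moved, both sides would be multiplied by zero and strictness lost; the
        -- two-thirds bound on `B` excludes this.
        P-nonZero : ℕ.NonZero ∣ P ∣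
        P-nonZero = ℕ.>-nonZero (ℕₚ.*-cancelʳ-< 3 0 (∣ P ∣) (ℕₚ.≤-<-trans z≤n 2B<3P))
      B≡ : ∣ B ∣ ≡ ∣ P ∣ + ∣ B ─ N ∣
      B≡ = trans (∣p∣≡∣p∩q∣+∣p─q∣ B N) (cong (λ Q → ∣ Q ∣ + ∣ B ─ N ∣) (∩-comm B N))
      A≡ = ∣p∣≡∣p∩q∣+∣p─q∣ A C
      l<A∩C : l < ∣ A ∩ C ∣
      l<A∩C = two-thirds-arith (∣ P ∣) (∣ A ∩ C ∣) (∣ A ─ C ∣) (∣ B ─ N ∣)
        (subst (λ k → 2 * k < ∣ A ∩ C ∣ * 3) A≡ (subst (λ Q → 2 * ∣ A ∣ < ∣ Q ∣ * 3) (∩-comm C A) 2A<3C∩A))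
        (subst (λ k → 2 * k < ∣ P ∣ * 3) B≡ 2B<3P)
        (≡.subst₂ _≤_ B≡ A≡ B≤A)

open PairCounting

-- The effect of an edit request

prune : (L : List (Subset n)) → AllPairs Disjoint L → (∀ x → Any (x ∈_) L) → Clustering n
prune L L∥ ⋃L = record
  { clusters = filter nonempty? L
  ; nonempty = All.all-filter nonempty? L
  ; disjoint = AllPairs.filter⁺ nonempty? L∥
  ; cover    = λ x → let A , A∈ , x∈A = List.find (⋃L x) in List.lose (∈-filter⁺ nonempty? A∈ (x , x∈A)) x∈A
  }

Together-filter-nonempty : (L : List (Subset n)) → ∀ {u v} →
  Together (filter nonempty? L) u v ⇔ Together L u v
Together-filter-nonempty L = mk⇔ (Any.filter⁻ nonempty?) λ t →
  let A , A∈ , u∈A , v∈A = List.find t in List.lose (∈-filter⁺ nonempty? A∈ (_ , u∈A)) (u∈A , v∈A)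

-- Reconciles `Edit`, which prunes only the two changed clusters, with `prune`, which filters the
-- whole list.
filter-nonempty-++ : (K : List (Subset n)) {R : List (Subset n)} → All Nonempty R →
  filter nonempty? (K ++ R) ≡ filter nonempty? K ++ R
filter-nonempty-++ K {R} R≠∅ = ≡.trans (filter-++ nonempty? K R)
  (≡.cong (filter nonempty? K ++_) (filter-all nonempty? R≠∅))

moved-cover : (A B N : Subset n) {R : List (Subset n)} → ∀ {x} → Any (x ∈_) (A ∷ B ∷ R) →
  Any (x ∈_) (A ∪ (N ∩ B) ∷ (B ─ N) ∷ R)
moved-cover A B N (here x∈A)        = here (p⊆p∪q (N ∩ B) x∈A)
moved-cover A B N (there (there x∈R)) = there (there x∈R)
moved-cover A B N {x = x} (there (here x∈B)) with x ∈? N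
... | yes x∈N = here (q⊆p∪q A (N ∩ B) (x∈p∩q⁺ (x∈N , x∈B)))
... | no  x∉N = there (here (x∈p∧x∉q⇒x∈p─q x∈B x∉N))

-- Deepest nodes of a tree

child-left : ∀ {T l r : Tree n} {d} → NodeAt T d (node l r) → NodeAt T (ℕ.suc d) l
child-left here      = left here
child-left (left i)  = left (child-left i)
child-left (right i) = right (child-left i)

child-right : ∀ {T l r : Tree n} {d} → NodeAt T d (node l r) → NodeAt T (ℕ.suc d) r
child-right here      = right here
child-right (left i)  = left (child-right i)
child-right (right i) = right (child-right i)

-- A request can be exhibited only together with the node it uses, which has to be found. Any
-- witness in a subtree lies deeper than the root, so the root is tried only when both subtrees have
-- none.
deepest : {P : Subset n → Set p} → (∀ A → Dec (P A)) → ∀ T →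
  ∃ (Deepest T P) ⊎ (∀ {d N} → NodeAt T d N → ¬ P (points N))
deepest P? (leaf x) with P? ⁅ x ⁆
... | yes Px = inj₁ (leaf x , 0 , here , Px , λ { here _ → ℕ.z≤n })
... | no ¬Px = inj₂ λ { here → ¬Px }
deepest P? (node l r) with deepest P? l | deepest P? r
... | inj₁ (N , d , i , PN , max) | inj₂ none = inj₁ (N , ℕ.suc d , left i , PN , λ
  { here _ → ℕ.z≤n ; (left j) PM → ℕ.s≤s (max j PM) ; (right j) PM → contradiction PM (none j) })
... | inj₂ none | inj₁ (N , d , i , PN , max) = inj₁ (N , ℕ.suc d , right i , PN , λ
  { here _ → ℕ.z≤n ; (right j) PM → ℕ.s≤s (max j PM) ; (left j) PM → contradiction PM (none j) })
... | inj₁ (N , d , i , PN , max) | inj₁ (N′ , d′ , i′ , PN′ , max′) with ℕₚ.≤-total d′ d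
...   | inj₁ d′≤d = inj₁ (N , ℕ.suc d , left i , PN , λ
  { here _ → ℕ.z≤n ; (left j) PM → ℕ.s≤s (max j PM) ; (right j) PM → ℕ.s≤s (ℕₚ.≤-trans (max′ j PM) d′≤d) })
...   | inj₂ d≤d′ = inj₁ (N′ , ℕ.suc d′ , right i′ , PN′ , λ
  { here _ → ℕ.z≤n ; (right j) PM → ℕ.s≤s (max′ j PM) ; (left j) PM → ℕ.s≤s (ℕₚ.≤-trans (max j PM) d≤d′) })
deepest P? (node l r) | inj₂ none | inj₂ none′ with P? (points l ∪ points r)
... | yes PN = inj₁ (node l r , 0 , here , PN , λ
  { here _ → ℕ.z≤n ; (left j) PM → contradiction PM (none j) ; (right j) PM → contradiction PM (none′ j) })
... | no ¬PN = inj₂ λ { here → ¬PN ; (left j) → none j ; (right j) → none′ j }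

-- In the second case the pair is brought to the front of the list, the form in which a merge
-- request takes its two clusters.
allPairs-or-pair : {A : Set a} {R : A → A → Set r} → (∀ x y → Dec (R x y)) → ∀ xs →
  AllPairs (λ x y → ¬ R x y) xs ⊎ ∃₂ λ x y → ∃ λ zs → xs ↭ x ∷ y ∷ zs × R x y
allPairs-or-pair R? []       = inj₁ []
allPairs-or-pair R? (x ∷ xs) with any? (R? x) xs | allPairs-or-pair R? xs
... | yes some | _ = let y , y∈ , Rxy = List.find some ; zs , xs↭ = ∈⇒↭∷ y∈ in
  inj₂ (x , y , zs , ↭-prep x xs↭ , Rxy)
... | no none  | inj₁ ¬Rs = inj₁ (All.¬Any⇒All¬ xs none ∷ ¬Rs)
... | no none  | inj₂ (y , z , zs , xs↭ , Ryz) =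
  inj₂ (y , z , x ∷ zs , ↭-trans (↭-prep x xs↭) (shifts (x ∷ []) (y ∷ z ∷ [])) , Ryz)

-- A repeated cluster would be disjoint from itself, hence empty.
clusters-unique : (D : Clustering n) → Unique (clusters D)
clusters-unique D = go (nonempty D) (disjoint D)
  where
  go : ∀ {L : List (Subset _)} → All Nonempty L → AllPairs Disjoint L → Unique L
  go []                    []           = []
  go ((x , x∈A) ∷ L≠∅) (A∥L ∷ L∥) =
    All.map (λ {A∥B ≡.refl → A∥B (x , x∈p∩q⁺ (x∈A , x∈A))}) A∥L ∷ go L≠∅ L∥

clusterOf : (D : Clustering n) → ∀ x → ∃ λ A → A List.∈ clusters D × x ∈ A
clusterOf D x = List.find (cover D x)

-- Recognising the target clustering

Cohabit : Clustering n → Subset n → Subset n → Set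
Cohabit target A B = Any (λ C → A ⊆ C × B ⊆ C) (clusters target)

cohabit⁺ : (target : Clustering n) → ∀ {A B C} →
  C List.∈ clusters target → A ⊆ C → B ⊆ C → Cohabit target A B
cohabit⁺ target {A} {B} C∈ A⊆C B⊆C = List.lose {P = λ C → A ⊆ C × B ⊆ C} C∈ (A⊆C , B⊆C)

-- A point of `C` outside `A` would lie in another cluster of `D`, necessarily inside `C`, and the
-- two would cohabit. So both lists have the same members, and as neither has repetitions they are
-- permutations of each other.
refinement⇒↭ : (D target : Clustering n) →
  (∀ {A} → A List.∈ clusters D → ∃ λ C → C List.∈ clusters target × A ⊆ C) →
  AllPairs (λ A B → ¬ Cohabit target A B) (clusters D) → clusters D ↭ clusters target
refinement⇒↭ D target refines ¬cohabit =
  ∼bag⇒↭ (unique∧set⇒bag (clusters-unique D) (clusters-unique target) (mk⇔ to from))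
  where
  to : ∀ {A} → A List.∈ clusters D → A List.∈ clusters target
  to {A} A∈ with refines A∈
  ... | C , C∈ , A⊆C = ≡.subst (List._∈ clusters target) (⊆-antisym C⊆A A⊆C) C∈
    where
    C⊆A : C ⊆ A
    C⊆A {x} x∈C with clusterOf D x
    ... | B , B∈ , x∈B with refines B∈
    ...   | C′ , C′∈ , B⊆C′ with disjoint-unique (disjoint target) C′∈ C∈ (B⊆C′ x∈B) x∈C
    ...     | ≡.refl with ∈-AllPairs₂ ¬cohabit A∈ B∈
    ...       | inj₁ ≡.refl    = x∈B
    ...       | inj₂ (inj₁ ¬c) = contradiction (cohabit⁺ target C∈ A⊆C B⊆C′) ¬c
    ...       | inj₂ (inj₂ ¬c) = contradiction (cohabit⁺ target C∈ B⊆C′ A⊆C) ¬c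
  from : ∀ {C} → C List.∈ clusters target → C List.∈ clusters D
  from C∈ with All.lookup (nonempty target) C∈
  ... | x , x∈C with clusterOf D x
  ...   | A , A∈ , x∈A = ≡.subst (List._∈ clusters D)
            (disjoint-unique (disjoint target) (to A∈) C∈ x∈A x∈C) A∈

-- Decrease of the error and existence of requests

module _ (F : OrderedField c ℓ₁ ℓ₂) where
  open OrderedField F

  module _ {n : ℕ} (target : Clustering n) (T : Tree n)
    (T-laminar : Laminar (clusters target) T) (T-full : ∀ x → x ∈ points T)
    (η : Carrier) (2/3<η : fromℕ 2 * fromℕ 3 ⁻¹ < η) where
    open OrderedFieldProperties F

    private
      Contains : Subset n → Subset n → Set _
      Contains = ContainsFraction F T target η

      compatible-at : ∀ {d N} → NodeAt T d N → ∀ {C} → C List.∈ clusters target → Compatible (points N) C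
      compatible-at i C∈ = All.lookup (laminar⇒compatible (laminar-at T-laminar i)) C∈

    contains⇒two-thirds : ∀ {A} P → Nonempty A → Contains A P → 2 ℕ.* ∣ A ∣ ℕ.< ∣ P ∩ A ∣ ℕ.* 3
    contains⇒two-thirds {A} P A≠∅ = two-thirds-< 2/3<η (∣ P ∩ A ∣) (nonempty⇒0<∣p∣ A≠∅)

    contains-mono : ∀ {A P Q} → P ⊆ Q → Contains A P → Contains A Q
    contains-mono {A} {P} {Q} P⊆Q η∣A∣≤ = begin
      η * fromℕ ∣ A ∣    ≤⟨ η∣A∣≤ ⟩
      fromℕ ∣ P ∩ A ∣    ≤⟨ fromℕ-mono-≤ (p⊆q⇒∣p∣≤∣q∣ λ x∈ → let x∈P , x∈A = x∈p∩q⁻ P A x∈ in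
                              x∈p∩q⁺ (P⊆Q x∈P , x∈A)) ⟩
      fromℕ ∣ Q ∩ A ∣    ∎
      where open ≤-Reasoning

    -- Each of the two sets takes more than two thirds of `A`, which leaves no room for them to be
    -- disjoint.
    contains⇒¬disjoint : ∀ {A P Q} → Nonempty A → Contains A P → Contains A Q → ¬ Disjoint P Q
    contains⇒¬disjoint {A} {P} {Q} A≠∅ A⊑P A⊑Q P∥Q = ℕₚ.<-irrefl ≡.refl (begin-strict
      (∣ P ∩ A ∣ ℕ.+ ∣ Q ∩ A ∣) ℕ.* 3           ≤⟨ ℕₚ.*-monoˡ-≤ 3 P∩A+Q∩A≤A ⟩
      ∣ A ∣ ℕ.* 3                               ≤⟨ ℕₚ.*-monoʳ-≤ (∣ A ∣) (ℕₚ.n≤1+n 3) ⟩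
      ∣ A ∣ ℕ.* 4                               ≡⟨ four (∣ A ∣) ⟩
      2 ℕ.* ∣ A ∣ ℕ.+ 2 ℕ.* ∣ A ∣               <⟨ ℕₚ.+-mono-< (contains⇒two-thirds P A≠∅ A⊑P)
                                                                (contains⇒two-thirds Q A≠∅ A⊑Q) ⟩
      ∣ P ∩ A ∣ ℕ.* 3 ℕ.+ ∣ Q ∩ A ∣ ℕ.* 3       ≡⟨ ℕₚ.*-distribʳ-+ 3 (∣ P ∩ A ∣) (∣ Q ∩ A ∣) ⟨
      (∣ P ∩ A ∣ ℕ.+ ∣ Q ∩ A ∣) ℕ.* 3           ∎)
      where
      open ℕₚ.≤-Reasoning
      four : ∀ k → k ℕ.* 4 ≡ 2 ℕ.* k ℕ.+ 2 ℕ.* k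
      four = solve-∀
      Q∩A⊆A─P : Q ∩ A ⊆ A ─ P
      Q∩A⊆A─P {x} x∈ = let x∈Q , x∈A = x∈p∩q⁻ Q A x∈ in
        x∈p∧x∉q⇒x∈p─q x∈A λ x∈P → P∥Q (x , x∈p∩q⁺ (x∈P , x∈Q))
      P∩A+Q∩A≤A : ∣ P ∩ A ∣ ℕ.+ ∣ Q ∩ A ∣ ℕ.≤ ∣ A ∣
      P∩A+Q∩A≤A = begin
        ∣ P ∩ A ∣ ℕ.+ ∣ Q ∩ A ∣  ≡⟨ ≡.cong (λ B → ∣ B ∣ ℕ.+ ∣ Q ∩ A ∣) (∩-comm P A) ⟩
        ∣ A ∩ P ∣ ℕ.+ ∣ Q ∩ A ∣  ≤⟨ ℕₚ.+-monoʳ-≤ (∣ A ∩ P ∣) (p⊆q⇒∣p∣≤∣q∣ Q∩A⊆A─P) ⟩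
        ∣ A ∩ P ∣ ℕ.+ ∣ A ─ P ∣  ≡⟨ ∣p∣≡∣p∩q∣+∣p─q∣ A P ⟨
        ∣ A ∣                    ∎

    -- A node that properly contains C has a child containing C, which is deeper.
    mergeNode⊆ : ∀ {A B C N} → Nonempty A → C List.∈ clusters target → Contains A C → Contains B C →
      MergeNode F T target η A B N → points N ⊆ C
    mergeNode⊆ {A} {B} {C} {N} A≠∅ C∈ A⊑C B⊑C (d , i , (A⊑N , B⊑N) , max) with compatible-at i C∈
    ... | inj₁ N⊆C        = N⊆C
    ... | inj₂ (inj₂ N∥C) = contradiction N∥C (contains⇒¬disjoint A≠∅ A⊑N A⊑C)
    ... | inj₂ (inj₁ C⊆N) = shrink N i C⊆N
      where
      too-deep : ∀ {M} → NodeAt T (ℕ.suc d) M → ¬ C ⊆ points M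
      too-deep j C⊆M = ℕₚ.1+n≰n (max j (contains-mono C⊆M A⊑C , contains-mono C⊆M B⊑C))

      shrink : ∀ N → NodeAt T d N → C ⊆ points N → points N ⊆ C
      shrink (leaf x) i C⊆x y∈x with All.lookup (nonempty target) C∈
      ... | z , z∈C = ≡.subst (_∈ C) (≡.trans (x∈⁅y⁆⇒x≡y x (C⊆x z∈C)) (≡.sym (x∈⁅y⁆⇒x≡y x y∈x))) z∈C
      shrink (node l r) i C⊆N with compatible-at (child-left i) C∈ | compatible-at (child-right i) C∈
      ... | inj₁ l⊆C        | inj₁ r⊆C        = λ y∈ → [ l⊆C , r⊆C ]′ (x∈p∪q⁻ (points l) (points r) y∈)
      ... | inj₂ (inj₁ C⊆l) | _               = ⊥-elim (too-deep (child-left i) C⊆l)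
      ... | _               | inj₂ (inj₁ C⊆r) = ⊥-elim (too-deep (child-right i) C⊆r)
      ... | inj₂ (inj₂ l∥C) | _               = ⊥-elim (too-deep (child-right i) C⊆r)
        where
        C⊆r : C ⊆ points r
        C⊆r {y} y∈C with x∈p∪q⁻ (points l) (points r) (C⊆N y∈C)
        ... | inj₁ y∈l = contradiction (y , x∈p∩q⁺ (y∈l , y∈C)) l∥C
        ... | inj₂ y∈r = y∈r
      ... | inj₁ l⊆C        | inj₂ (inj₂ r∥C) = ⊥-elim (too-deep (child-left i) C⊆l)
        where
        C⊆l : C ⊆ points l
        C⊆l {y} y∈C with x∈p∪q⁻ (points l) (points r) (C⊆N y∈C)
        ... | inj₁ y∈l = y∈l
        ... | inj₂ y∈r = contradiction (y , x∈p∩q⁺ (y∈r , y∈C)) r∥C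

    split-⊈ : ∀ {A C} → SplitAllowed F T target η A → C List.∈ clusters target → ¬ A ⊆ C
    split-⊈ {A} (C₁ , C₂ , C₁∈ , C₂∈ , C₁≢C₂ , (x , x∈) , (y , y∈)) C∈ A⊆C =
      let x∈A , x∈C₁ = x∈p∩q⁻ A C₁ x∈
          y∈A , y∈C₂ = x∈p∩q⁻ A C₂ y∈
      in C₁≢C₂ (≡.trans (disjoint-unique (disjoint target) C₁∈ C∈ x∈C₁ (A⊆C x∈A))
                        (disjoint-unique (disjoint target) C∈ C₂∈ (A⊆C y∈A) y∈C₂))

    step-decreases : (D : Clustering n) → ∀ {L} → Edit F T target η (clusters D) L →
      ∃ λ E → clusters E ≡ L × δcc E target ℕ.< δcc D target
    step-decreases D (split {A} {R} {N₁} {N₂} D↭ allowed (d , i , A⊆N , max)) =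
      E , ≡.refl , split-decreases D E target D↭ ↭-refl (p∩q⊆p A (points N₁)) (p∩q⊆p A (points N₂)) parts
                     separated X≠∅ Y≠∅
      where
      X = A ∩ points N₁
      Y = A ∩ points N₂
      D∥ : AllPairs Disjoint (A ∷ R)
      D∥ = AllPairs-disjoint-resp-↭ D↭ (disjoint D)
      D≠∅ : All Nonempty (A ∷ R)
      D≠∅ = All-resp-↭ D↭ (nonempty D)

      N₁∥N₂ : Disjoint (points N₁) (points N₂)
      N₁∥N₂ with node N₁∥N₂ _ _ _ ← laminar-at T-laminar i = N₁∥N₂

      parts : ∀ {x} → x ∈ A → x ∈ X ⊎ x ∈ Y
      parts x∈A = Sum.map (λ x∈N₁ → x∈p∩q⁺ (x∈A , x∈N₁)) (λ x∈N₂ → x∈p∩q⁺ (x∈A , x∈N₂))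
        (x∈p∪q⁻ (points N₁) (points N₂) (A⊆N x∈A))

      -- A split does not discard empty parts, so both must be shown nonempty. If `X` were empty,
      -- the right child would contain `A` and be deeper than the deepest such node.
      X≠∅ : Nonempty X
      X≠∅ with nonempty? X
      ... | yes X≠∅ = X≠∅
      ... | no  X≡∅ = contradiction (max (child-right i) λ {x} x∈A →
        [ (λ x∈X → contradiction (x , x∈X) X≡∅) , p∩q⊆q A (points N₂) ]′ (parts x∈A)) ℕₚ.1+n≰n

      Y≠∅ : Nonempty Y
      Y≠∅ with nonempty? Y
      ... | yes Y≠∅ = Y≠∅
      ... | no  Y≡∅ = contradiction (max (child-left i) λ {x} x∈A →
        [ p∩q⊆q A (points N₁) , (λ x∈Y → contradiction (x , x∈Y) Y≡∅) ]′ (parts x∈A)) ℕₚ.1+n≰n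

      in-child : ∀ {N C x y} → (∃ λ d′ → NodeAt T d′ N) → C List.∈ clusters target →
        x ∈ points N → x ∈ C → y ∉ points N → y ∈ C → points N ⊆ C
      in-child {x = x} (_ , j) C∈ x∈N x∈C y∉N y∈C with compatible-at j C∈
      ... | inj₁ N⊆C        = N⊆C
      ... | inj₂ (inj₁ C⊆N) = contradiction (C⊆N y∈C) y∉N
      ... | inj₂ (inj₂ N∥C) = contradiction (x , x∈p∩q⁺ (x∈N , x∈C)) N∥C

      -- A target cluster with points in both children lies inside neither, so by compatibility it
      -- contains both. It would then contain `A`, and the split would not be allowed.
      separated : ∀ {u v} → u ∈ X → v ∈ Y → ¬ Together (clusters target) u v
      separated {u} {v} u∈X v∈Y t with List.find t
      ... | C , C∈ , u∈C , v∈C = split-⊈ allowed C∈ λ x∈A →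
        [ in-child (_ , child-left i) C∈ u∈N₁ u∈C (λ v∈N₁ → N₁∥N₂ (v , x∈p∩q⁺ (v∈N₁ , v∈N₂))) v∈C
        , in-child (_ , child-right i) C∈ v∈N₂ v∈C (λ u∈N₂ → N₁∥N₂ (u , x∈p∩q⁺ (u∈N₁ , u∈N₂))) u∈C
        ]′ (x∈p∪q⁻ (points N₁) (points N₂) (A⊆N x∈A))
        where
        u∈N₁ = p∩q⊆q A (points N₁) u∈X
        v∈N₂ = p∩q⊆q A (points N₂) v∈Y

      regroup : ∀ {x} → Any (x ∈_) (A ∷ R) → Any (x ∈_) (X ∷ Y ∷ R)
      regroup (here x∈A)  = [ here , there ∘ here ]′ (parts x∈A)
      regroup (there x∈R) = there (there x∈R)

      part-disjoint : ∀ N → All (Disjoint (A ∩ N)) R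
      part-disjoint N = All.map (λ {M} A∥M (x , x∈) → let x∈A∩N , x∈M = x∈p∩q⁻ (A ∩ N) M x∈ in
        A∥M (x , x∈p∩q⁺ (p∩q⊆p A N x∈A∩N , x∈M))) (AllPairs.head D∥)

      E : Clustering n
      E = record
        { clusters = X ∷ Y ∷ R
        ; nonempty = X≠∅ ∷ Y≠∅ ∷ All.tail D≠∅
        ; disjoint = ((λ (x , x∈) → let x∈X , x∈Y = x∈p∩q⁻ X Y x∈ in
                         N₁∥N₂ (x , x∈p∩q⁺ (p∩q⊆q A (points N₁) x∈X , p∩q⊆q A (points N₂) x∈Y)))
                       ∷ part-disjoint (points N₁))
                     ∷ part-disjoint (points N₂) ∷ AllPairs.tail D∥
        ; cover    = λ x → regroup (Any-resp-↭ D↭ (cover D x))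
        }
    step-decreases D (mergeˡ {A} {B} {R} {N} D↭ (C , C∈ , A⊑C , B⊑C) N-node@(_ , _ , (_ , B⊑N) , _) B≤A)
      with All-resp-↭ D↭ (nonempty D)
    ... | A≠∅ ∷ B≠∅ ∷ R≠∅ =
      E , filter-nonempty-++ (A ∪ (points N ∩ B) ∷ (B ─ points N) ∷ []) R≠∅ ,
      merge-decreases D E target D↭ (Together-filter-nonempty K) C∈
        (mergeNode⊆ A≠∅ C∈ A⊑C B⊑C N-node ∘ p∩q⊆p (points N) B) B≤A
        (contains⇒two-thirds C A≠∅ A⊑C) (contains⇒two-thirds (points N) B≠∅ B⊑N)
      where
      K = A ∪ (points N ∩ B) ∷ (B ─ points N) ∷ R
      E = prune K (moved-disjoint A B (points N) (AllPairs-disjoint-resp-↭ D↭ (disjoint D)))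
        λ x → moved-cover A B (points N) (Any-resp-↭ D↭ (cover D x))
    step-decreases D (mergeʳ {A} {B} {R} {N} D↭ (C , C∈ , A⊑C , B⊑C) N-node@(_ , _ , (A⊑N , _) , _) A<B)
      with All-resp-↭ D↭ (nonempty D)
    ... | A≠∅ ∷ B≠∅ ∷ R≠∅ =
      E , filter-nonempty-++ ((A ─ points N) ∷ B ∪ (points N ∩ A) ∷ []) R≠∅ ,
      merge-decreases D E target D↭′
        (mk⇔ (Any-resp-↭ K↭ ∘ Equivalence.to (Together-filter-nonempty _))
             (Equivalence.from (Together-filter-nonempty _) ∘ Any-resp-↭ (↭-sym K↭))) C∈
        (mergeNode⊆ A≠∅ C∈ A⊑C B⊑C N-node ∘ p∩q⊆p (points N) A) (ℕₚ.<⇒≤ A<B)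
        (contains⇒two-thirds C B≠∅ B⊑C) (contains⇒two-thirds (points N) A≠∅ A⊑N)
      where
      -- The count for a merge takes the growing cluster first. Here `B` grows, so the lists before
      -- and after are reordered to fit.
      D↭′ : clusters D ↭ B ∷ A ∷ R
      D↭′ = ↭-trans D↭ (↭-swap A B ↭-refl)
      K↭ : (A ─ points N) ∷ B ∪ (points N ∩ A) ∷ R ↭ B ∪ (points N ∩ A) ∷ (A ─ points N) ∷ R
      K↭ = ↭-swap _ _ ↭-refl
      E = prune ((A ─ points N) ∷ B ∪ (points N ∩ A) ∷ R)
        (AllPairs-disjoint-resp-↭ (↭-sym K↭)
          (moved-disjoint B A (points N) (AllPairs-disjoint-resp-↭ D↭′ (disjoint D))))
        λ x → Any-resp-↭ (↭-sym K↭) (moved-cover B A (points N) (Any-resp-↭ D↭′ (cover D x)))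

    -- Keeping the current error in the bound lets each request pay for itself. The state is also
    -- returned as a clustering, which the existence of a further request relies on.
    edits-bounded : (D : Clustering n) → ∀ {m L} → Edits F T target η (clusters D) m L →
      ∃ λ E → clusters E ≡ L × m ℕ.+ δcc E target ℕ.≤ δcc D target
    edits-bounded D done = D , ≡.refl , ℕₚ.≤-refl
    edits-bounded D (_▷_ {m} edits edit) with edits-bounded D edits
    ... | D′ , ≡.refl , m+δ′≤δ with step-decreases D′ edit
    ...   | E , ≡.refl , δ″<δ′ = E , ≡.refl , (begin
      ℕ.suc (m ℕ.+ δcc E target)  ≡⟨ ℕₚ.+-suc m _ ⟨
      m ℕ.+ ℕ.suc (δcc E target)  ≤⟨ ℕₚ.+-monoʳ-≤ m δ″<δ′ ⟩
      m ℕ.+ δcc D′ target         ≤⟨ m+δ′≤δ ⟩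
      δcc D target                ∎)
      where open ℕₚ.≤-Reasoning

    -- The premise `Nonempty A` covers the empty set, for which no point selects a target cluster:
    -- `All.decide` asks for an alternative valid for every subset.
    within-cluster-or-splittable : ∀ A →
      (Nonempty A → ∃ λ C → C List.∈ clusters target × A ⊆ C) ⊎ SplitAllowed F T target η A
    within-cluster-or-splittable A with nonempty? A
    ... | no  A≡∅ = inj₁ λ A≠∅ → contradiction A≠∅ A≡∅
    ... | yes (x , x∈A) with clusterOf target x
    ...   | C , C∈ , x∈C with nonempty? (A ─ C)
    ...     | no A─C≡∅ = inj₁ λ _ → C , C∈ , A⊆C
      where
      A⊆C : A ⊆ C
      A⊆C {y} y∈A with y ∈? C
      ... | yes y∈C = y∈C
      ... | no  y∉C = contradiction (y , x∈p∧x∉q⇒x∈p─q y∈A y∉C) A─C≡∅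
    ...     | yes (y , y∈A─C) with x∈p─q⁻ A C y∈A─C | clusterOf target y
    ...       | y∈A , y∉C | C′ , C′∈ , y∈C′ =
      inj₂ (C , C′ , C∈ , C′∈ , (λ {≡.refl → y∉C y∈C′}) ,
        (x , x∈p∩q⁺ (x∈A , x∈C)) , (y , x∈p∩q⁺ (y∈A , y∈C′)))

    deepest-exists : {P : Subset n → Set p} → (∀ A → Dec (P A)) → P (points T) → ∃ (Deepest T P)
    deepest-exists P? PT with deepest P? T
    ... | inj₁ found = found
    ... | inj₂ none  = contradiction PT (none here)

    split-possible : ∀ {L A} → A List.∈ L → SplitAllowed F T target η A → ∃ (Edit F T target η L)
    split-possible {L} {A} A∈ allowed with ∈⇒↭∷ A∈ | deepest-exists (A ⊆?_) (λ {x} _ → T-full x)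
    ... | R , L↭ | node N₁ N₂ , N-deepest = _ , split L↭ allowed N-deepest
    -- A cluster inside a leaf has at most one point and cannot meet two target clusters.
    ... | R , L↭ | leaf x , _ , _ , A⊆x , _ with clusterOf target x
    ...   | C , C∈ , x∈C = ⊥-elim (split-⊈ allowed C∈ λ y∈A →
      ≡.subst (_∈ C) (≡.sym (x∈⁅y⁆⇒x≡y x (A⊆x y∈A))) x∈C)

    -- This is where `η ≤ 1#` enters: for larger `η`, not even a set containing all of `A` would
    -- hold the required fraction of it.
    ⊆⇒contains : η ≤ 1# → ∀ {A P} → Nonempty A → A ⊆ P → Contains A P
    ⊆⇒contains η≤1 {A} {P} A≠∅ A⊆P = begin
      η * fromℕ ∣ A ∣    ≤⟨ *-monoˡ-≤ (fromℕ-pos (nonempty⇒0<∣p∣ A≠∅)) η≤1 ⟩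
      1# * fromℕ ∣ A ∣   ≈⟨ *-identityˡ _ ⟩
      fromℕ ∣ A ∣        ≤⟨ fromℕ-mono-≤ (p⊆q⇒∣p∣≤∣q∣ λ x∈A → x∈p∩q⁺ (A⊆P x∈A , x∈A)) ⟩
      fromℕ ∣ P ∩ A ∣    ∎
      where open ≤-Reasoning

    merge-possible : η ≤ 1# → ∀ {L A B R} → L ↭ A ∷ B ∷ R → Nonempty A → Nonempty B →
      Cohabit target A B → ∃ (Edit F T target η L)
    merge-possible η≤1 {L} {A} {B} L↭ A≠∅ B≠∅ cohabit with List.find cohabit
    ... | C , C∈ , A⊆C , B⊆C
      with deepest-exists (λ P → (η * fromℕ ∣ A ∣ ≤? fromℕ ∣ P ∩ A ∣) ×-dec
                                 (η * fromℕ ∣ B ∣ ≤? fromℕ ∣ P ∩ B ∣))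
             (⊆⇒contains η≤1 A≠∅ (λ {x} _ → T-full x) , ⊆⇒contains η≤1 B≠∅ (λ {x} _ → T-full x))
         | (∣ B ∣) ℕₚ.≤? (∣ A ∣)
    ... | N , N-deepest | yes B≤A = _ , mergeˡ L↭
      (C , C∈ , ⊆⇒contains η≤1 A≠∅ A⊆C , ⊆⇒contains η≤1 B≠∅ B⊆C) N-deepest B≤A
    ... | N , N-deepest | no  B≰A = _ , mergeʳ L↭
      (C , C∈ , ⊆⇒contains η≤1 A≠∅ A⊆C , ⊆⇒contains η≤1 B≠∅ B⊆C) N-deepest (ℕₚ.≰⇒> B≰A)

    target-or-edit : η ≤ 1# → (D : Clustering n) →
      (clusters D ↭ clusters target) ⊎ ∃ (Edit F T target η (clusters D))
    target-or-edit η≤1 D with All.decide within-cluster-or-splittable (clusters D)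
    ... | inj₂ some = let A , A∈ , allowed = List.find some in inj₂ (split-possible A∈ allowed)
    ... | inj₁ within
      with allPairs-or-pair (λ A B → any? (λ C → (A ⊆? C) ×-dec (B ⊆? C)) (clusters target)) (clusters D)
    ...   | inj₁ ¬cohabit = inj₁ (refinement⇒↭ D target
      (λ A∈ → All.lookup within A∈ (All.lookup (nonempty D) A∈)) ¬cohabit)
    ...   | inj₂ (A , B , R , D↭ , cohabit) with All-resp-↭ D↭ (nonempty D)
    ...     | A≠∅ ∷ B≠∅ ∷ _ = inj₂ (merge-possible η≤1 D↭ A≠∅ B≠∅ cohabit)

theorem15 : ∀ {c ℓ₁ ℓ₂} (F : OrderedField c ℓ₁ ℓ₂) (let open OrderedField F)
    {n : ℕ} (S : Fin n → Fin n → Carrier) → (∀ x y → S x y ≈ S y x) →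
    (target : Clustering n) → Stable F S target →
    (T : Tree n) → IsAverageLinkageTree F S T →
    (η : Carrier) → fromℕ 2 * fromℕ 3 ⁻¹ < η →
    (initial : Clustering n) →
    ∀ {m D} → Edits F T target η (clusters initial) m D →
    (m ℕ.≤ δcc initial target) ×
    (η ≤ 1# → (D ↭ clusters target) ⊎ ∃ (Edit F T target η D))
theorem15 F S S-sym target stable T linkage η 2/3<η initial edits
  with averageLinkageTree-laminar F S S-sym target stable linkage
... | T-laminar , T-full with edits-bounded F target T T-laminar T-full η 2/3<η initial edits
...   | E , ≡.refl , m+δ≤δ₀ =
  ℕₚ.m+n≤o⇒m≤o _ m+δ≤δ₀ , λ η≤1 → target-or-edit F target T T-laminar T-full η 2/3<η η≤1 E
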